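{- Let $f(x)$, $G(x)$ and $g(x)$ be non-zero polynomials in $\mathbb{Z}[x]$ such that $f(x)$ has degree at least three. Suppose $f(x)$ has one of the following forms: (i) $f(x)=x^{2}(x+1)g(x)$; (ii) $f(x)=x(x+1)G(x)-x-1$; (iii) $f(x)=x(x+1)^{2}g(x)-1$; (iv) $f(x)=x(x+1)\big((x-1)g(x)+2\big)-2x-1$; (v) $f(x)=x(x+1)\big((x+2)g(x)-2\big)-2x-2$; (vi) $f(x)=x(x+1)\big(x(x-1)g(x)+1\big)-x$; (vii) $f(x)=x(x+1)\big((x+2)(x+1)g(x)-1\big)-x-2$. Then for each $n\geq 0$, $S_n$ is a specializable continued fraction, and hence $S_\infty$ is a specializable continued fraction.
   Context: For $f(x)\in\mathbb{Z}[x]$ set $f_0(x)=x$ and $f_{n+1}(x)=f(f_n(x))$. $S_n$ denotes the continued fraction expansion (via the Euclidean algorithm in $\mathbb{Q}[x]$) of the rational function $\prod_{i=0}^{n}(1+1/f_i(x))$, and $S_\infty$ the regular continued fraction expansion of $\prod_{i=0}^{\infty}(1+1/f_i(x))$ viewed as an element of the field $\mathbb{Q}((1/x))$ of formal Laurent series in $1/x$; all partial quotients are polynomials in $\mathbb{Q}[x]$. A continued fraction is called specializable if all of its partial quotients lie in $\mathbb{Z}[x]$. -}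

module Defs where

open import Data.Nat as ℕ using (ℕ; zero; suc)
open import Data.Integer as ℤ using (ℤ; +_; -[1+_])
import Data.Integer.Properties as ℤP
open import Data.Rational as ℚ using (ℚ; 0ℚ; 1ℚ)
open import Data.List using (List; []; _∷_; map; foldr; length)
open import Data.List.Relation.Unary.All using (All)
open import Data.Product using (Σ; ∃; _×_; _,_)
open import Data.Sum using (_⊎_)
open import Data.Empty using (⊥-elim)
open import Relation.Nullary using (¬_; yes; no)
open import Relation.Binary.PropositionalEquality using (_≡_; refl)

-- Polynomials as coefficient lists (constant term first), generic over
-- a coefficient type with 0, + and *.  Equality is coefficientwise, so
-- trailing zeros are irrelevant.

module PolyOps {A : Set} (0# : A) (_⊕_ _⊗_ : A → A → A) where

  Poly : Set
  Poly = List A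

  coeff : Poly → ℕ → A
  coeff []      _       = 0#
  coeff (a ∷ p) zero    = a
  coeff (a ∷ p) (suc k) = coeff p k

  infix 4 _≈_
  _≈_ : Poly → Poly → Set
  p ≈ q = ∀ k → coeff p k ≡ coeff q k

  infixl 6 _+ₚ_
  _+ₚ_ : Poly → Poly → Poly
  []      +ₚ q       = q
  (a ∷ p) +ₚ []      = a ∷ p
  (a ∷ p) +ₚ (b ∷ q) = (a ⊕ b) ∷ (p +ₚ q)

  scale : A → Poly → Poly
  scale a p = map (a ⊗_) p

  infixl 7 _*ₚ_
  _*ₚ_ : Poly → Poly → Poly
  []      *ₚ q = []
  (a ∷ p) *ₚ q = scale a q +ₚ (0# ∷ (p *ₚ q))

  _∘ₚ_ : Poly → Poly → Poly
  []      ∘ₚ q = []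
  (a ∷ p) ∘ₚ q = (a ∷ []) +ₚ (q *ₚ (p ∘ₚ q))

  NonZeroP : Poly → Set
  NonZeroP p = ∃ λ k → ¬ (coeff p k ≡ 0#)

  IsZeroP : Poly → Set
  IsZeroP p = ∀ k → coeff p k ≡ 0#

module Z = PolyOps (+ 0) ℤ._+_ ℤ._*_
ZPoly : Set
ZPoly = List ℤ

module Q = PolyOps 0ℚ ℚ._+_ ℚ._*_
QPoly : Set
QPoly = List ℚ

open Z using () renaming (_+ₚ_ to _+z_; _*ₚ_ to _*z_; _≈_ to _≈z_)

Xz : ZPoly
Xz = + 0 ∷ + 1 ∷ []

cz : ℤ → ZPoly
cz c = c ∷ []

_-z_ : ZPoly → ZPoly → ZPoly
p -z q = p +z Z.scale (ℤ.- (+ 1)) q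

infixl 6 _-z_

Form : ZPoly → ZPoly → ZPoly → Set
Form f G g =
    (f ≈z Xz *z Xz *z (Xz +z cz (+ 1)) *z g)
  ⊎ (f ≈z Xz *z (Xz +z cz (+ 1)) *z G -z Xz -z cz (+ 1))
  ⊎ (f ≈z Xz *z (Xz +z cz (+ 1)) *z (Xz +z cz (+ 1)) *z g -z cz (+ 1))
  ⊎ (f ≈z Xz *z (Xz +z cz (+ 1)) *z ((Xz -z cz (+ 1)) *z g +z cz (+ 2))
          -z cz (+ 2) *z Xz -z cz (+ 1))
  ⊎ (f ≈z Xz *z (Xz +z cz (+ 1)) *z ((Xz +z cz (+ 2)) *z g -z cz (+ 2))
          -z cz (+ 2) *z Xz -z cz (+ 2))
  ⊎ (f ≈z Xz *z (Xz +z cz (+ 1)) *z (Xz *z (Xz -z cz (+ 1)) *z g +z cz (+ 1))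
          -z Xz)
  ⊎ (f ≈z Xz *z (Xz +z cz (+ 1))
          *z ((Xz +z cz (+ 2)) *z (Xz +z cz (+ 1)) *z g -z cz (+ 1))
          -z Xz -z cz (+ 2))

DegAtLeast3 : ZPoly → Set
DegAtLeast3 f = ∃ λ d → (3 ℕ.≤ d) × ¬ (Z.coeff f d ≡ + 0)

toℚ : ℤ → ℚ
toℚ z = z ℚ./ 1

emb : ZPoly → QPoly
emb = map toℚ

IsIntPoly : QPoly → Set
IsIntPoly p = ∃ λ (z : ZPoly) → emb z Q.≈ p

Specializable : List QPoly → Set
Specializable qs = All IsIntPoly qs

Xq : QPoly
Xq = 0ℚ ∷ 1ℚ ∷ []

iter : ZPoly → ℕ → QPoly
iter f zero    = Xq
iter f (suc n) = emb f Q.∘ₚ iter f n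

-- numerator ∏_{i≤n} (f_i + 1) and denominator ∏_{i≤n} f_i of
-- ∏_{i=0}^{n} (1 + 1/f_i)
numer : ZPoly → ℕ → QPoly
numer f zero    = iter f zero Q.+ₚ (1ℚ ∷ [])
numer f (suc n) = numer f n Q.*ₚ (iter f (suc n) Q.+ₚ (1ℚ ∷ []))

denom : ZPoly → ℕ → QPoly
denom f zero    = iter f zero
denom f (suc n) = denom f n Q.*ₚ iter f (suc n)

DegLt : QPoly → QPoly → Set
DegLt r D = ∃ λ d → ¬ (Q.coeff D d ≡ 0ℚ) × (∀ k → d ℕ.≤ k → Q.coeff r k ≡ 0ℚ)

data EuclidCF : QPoly → QPoly → List QPoly → Set where
  stop : ∀ {N D} → Q.IsZeroP D → EuclidCF N D []
  step : ∀ {N D q r qs} → Q.NonZeroP D →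
         N Q.≈ (q Q.*ₚ D) Q.+ₚ r → DegLt r D →
         EuclidCF D r qs → EuclidCF N D (q ∷ qs)

S-is : ZPoly → ℕ → List QPoly → Set
S-is f n qs = EuclidCF (numer f n) (denom f n) qs

-- Formal Laurent series in 1/x over ℚ:  Σ_{j ≤ top} c j x^j.

record Laurent : Set where
  field
    c   : ℤ → ℚ
    top : ℤ
    bnd : ∀ j → top ℤ.< j → c j ≡ 0ℚ
open Laurent public

infix 4 _≈L_
_≈L_ : Laurent → Laurent → Set
α ≈L β = ∀ j → c α j ≡ c β j

sumℚ : ℕ → (ℕ → ℚ) → ℚ
sumℚ zero    h = 0ℚ
sumℚ (suc n) h = sumℚ n h ℚ.+ h n

mulCoeff : Laurent → Laurent → ℤ → ℚ
mulCoeff α β j with j ℤP.≤? (top α ℤ.+ top β)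
... | yes _ = sumℚ (suc ℤ.∣ (top α ℤ.+ top β) ℤ.- j ∣)
                   (λ k → c α (j ℤ.- top β ℤ.+ + k) ℚ.* c β (top β ℤ.- + k))
... | no  _ = 0ℚ

mulBnd : ∀ α β j → (top α ℤ.+ top β) ℤ.< j → mulCoeff α β j ≡ 0ℚ
mulBnd α β j lt with j ℤP.≤? (top α ℤ.+ top β)
... | yes le = ⊥-elim (ℤP.<⇒≱ lt le)
... | no  _  = refl

infixl 7 _*L_
_*L_ : Laurent → Laurent → Laurent
α *L β = record { c = mulCoeff α β ; top = top α ℤ.+ top β ; bnd = mulBnd α β }

polyAt : QPoly → ℤ → ℚ
polyAt p (+ n)    = Q.coeff p n
polyAt p -[1+ n ] = 0ℚ

polyCoeff : QPoly → ℤ → ℚ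
polyCoeff p j with j ℤP.≤? + length p
... | yes _ = polyAt p j
... | no _  = 0ℚ

polyBnd : ∀ p j → + length p ℤ.< j → polyCoeff p j ≡ 0ℚ
polyBnd p j lt with j ℤP.≤? + length p
... | yes le = ⊥-elim (ℤP.<⇒≱ lt le)
... | no  _  = refl

embL : QPoly → Laurent
embL p = record { c = polyCoeff p ; top = + length p ; bnd = polyBnd p }

oneL : Laurent
oneL = embL (1ℚ ∷ [])

fracCoeff : Laurent → ℤ → ℚ
fracCoeff α j with + 0 ℤP.≤? j
... | yes _ = 0ℚ
... | no  _ = c α j

fracBnd : ∀ α j → + 0 ℤ.< j → fracCoeff α j ≡ 0ℚ
fracBnd α j lt with + 0 ℤP.≤? j
... | yes _  = refl
... | no ¬le = ⊥-elim (¬le (ℤP.<⇒≤ lt))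

frac : Laurent → Laurent
frac α = record { c = fracCoeff α ; top = + 0 ; bnd = fracBnd α }

IsPolyPart : Laurent → QPoly → Set
IsPolyPart α q = ∀ n → Q.coeff q n ≡ c α (+ n)

NonZeroL : Laurent → Set
NonZeroL α = ∃ λ j → ¬ (c α j ≡ 0ℚ)

data CFPrefix : Laurent → List QPoly → Set where
  nil  : ∀ {α} → CFPrefix α []
  cons : ∀ {α β q qs} → IsPolyPart α q → NonZeroL (frac α) →
         β *L frac α ≈L oneL → CFPrefix β qs → CFPrefix α (q ∷ qs)
  last : ∀ {α q} → IsPolyPart α q → CFPrefix α (q ∷ [])

-- F = ∏_{i=0}^∞ (1 + 1/f_i) in ℚ((1/x)): F is the 1/x-adic limit of the
-- partial products P_n = numer/denom (P_n the Laurent series with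
-- P_n · denom = numer).
IsInfProduct : ZPoly → Laurent → Set
IsInfProduct f F =
  ∀ (K : ℕ) → ∃ λ M → ∀ n → M ℕ.≤ n → ∀ (P : Laurent) →
    P *L embL (denom f n) ≈L embL (numer f n) →
    ∀ j → ℤ.- (+ K) ℤ.≤ j → c F j ≡ c P j

{-# OPTIONS --safe #-}
-- Put τ = 1, e_n = f_n in cases (i), (ii), (v), (vi) and τ = -1, e_n = f_n + 1 in the other
-- ones; the product of the 1 + τ / e_i is S_n, respectively 1 / S_n.  A continued fraction
-- [0; a₁, …, a_m] with value R / D is encoded by the matrix M = (D U ; R V), the product of
-- the (a_i 1 ; 1 0).  When n increases by one, the word w = (a₁, …, a_m) belonging to
-- τ (∏ (1 + τ / e_i) - 1) = R / D is prolonged, with an explicit integral q, to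
--   (w, q, - reverse w)    in cases (i) and (iii),
--   (w, q)                 in case (ii),
--   (w, q, w)              in cases (iv) and (v), where M is symmetric of determinant -1,
--   (w, q, ± D (D + τ R))  in cases (vi) and (vii).
-- Outside case (ii), q is integral because D (and D + τ R) divide simple polynomials in e_n.
-- Uniqueness of division identifies these words with the output of the Euclidean
-- algorithm.  For the infinite product, a partial product close enough to the limit
-- determines any given number of its partial quotients.
module Submission where

open import Defs
open import Level using (0ℓ)
open import Algebra.Bundles using (CommutativeRing)
open import Algebra.Structures using (IsCommutativeRing)
open import Data.Nat using (ℕ)
open import Data.Nat.Base as ℕ using (zero; suc)
import Data.Nat.Properties as ℕP
import Data.Nat.Solver
open import Data.Integer.Base as ℤ using (ℤ; +_; -[1+_])
import Data.Integer.Properties as ℤP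
import Data.Integer.Solver
open import Data.Rational.Base as ℚ using (ℚ; 0ℚ; 1ℚ)
import Data.Rational.Properties as ℚP
open import Data.Rational.Unnormalised.Base as ℚᵘ using (mkℚᵘ; *≡*)
import Data.Rational.Unnormalised.Properties as ℚᵘP
open import Data.List using (List; []; _∷_; length)
open import Data.List.Relation.Unary.All using ([]; _∷_)
open import Data.Maybe.Base using (Maybe; just; nothing)
open import Data.Product using (∃; _×_; _,_; proj₁; proj₂)
open import Data.Sum.Base using (_⊎_; inj₁; inj₂)
open import Data.Empty using (⊥-elim)
open import Relation.Nullary using (¬_; Dec; yes; no)
open import Relation.Binary.PropositionalEquality as ≡ using (_≡_)

-- The factor `1 + τ / e_(n+1)` adds `(D + τ R) / (D e_(n+1))` to `R / D`, whereas a longer word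
-- adds a fraction built from its new terms and from `det M`, which is 1 or -1. Once the shape of
-- the word is fixed, equating the two increments leaves one candidate for q, a quotient of
-- polynomials, and the obstacle is to see that it lies in ℤ[x]. Every form of f is made so that the
-- divisibilities needed for this hold at n = 0 and pass from n to n + 1; they are fields of the
-- `State` records. Substituting e = f + 1 turns (iii), (iv), (vii) into the recursions of (i), (v),
-- (vi) with the sign of τ reversed, which is why four recursions cover seven cases. The terms must
-- also be non-constant; in cases (ii), (vi), (vii) this is where the degree of f enters. The
-- products are not brought to lowest terms: a common factor u of numerator and denominator is
-- carried along, since it leaves the quotients of the division algorithm unchanged.

module ℕS = Data.Nat.Solver.+-*-Solver
module ℤS = Data.Integer.Solver.+-*-Solver

-- Ring identities with integer coefficients

module IntegerSolver (𝓡 : CommutativeRing 0ℓ 0ℓ) where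
  open CommutativeRing 𝓡
  open import Algebra.Properties.Ring ring using (-‿distribˡ-*; -‿distribʳ-*; -0#≈0#; -‿involutive)
  open import Algebra.Properties.AbelianGroup +-abelianGroup using (⁻¹-∙-comm)
  open import Algebra.Properties.Semiring.Mult.TCOptimised semiring using (1+×; ×-homo-+; ×1-homo-*) renaming (_×_ to _×ℕ_)
  open import Algebra.Solver.Ring.AlmostCommutativeRing using (_-Raw-AlmostCommutative⟶_; fromCommutativeRing)
  open import Relation.Binary.Reasoning.Setoid setoid

  ⟦_⟧ℤ : ℤ → Carrier
  ⟦ + n ⟧ℤ      = n ×ℕ 1#
  ⟦ -[1+ n ] ⟧ℤ = - (suc n ×ℕ 1#)

  ⊖-homo : ∀ m n → ⟦ m ℤ.⊖ n ⟧ℤ ≈ m ×ℕ 1# - n ×ℕ 1#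
  ⊖-homo m       zero    = sym (trans (+-congˡ -0#≈0#) (+-identityʳ _))
  ⊖-homo zero    (suc n) = sym (+-identityˡ _)
  ⊖-homo (suc m) (suc n) = begin
    ⟦ suc m ℤ.⊖ suc n ⟧ℤ            ≡⟨ ≡.cong ⟦_⟧ℤ (ℤP.[1+m]⊖[1+n]≡m⊖n m n) ⟩
    ⟦ m ℤ.⊖ n ⟧ℤ                    ≈⟨ ⊖-homo m n ⟩
    a - b                           ≈⟨ +-congʳ (+-identityʳ a) ⟨
    a + 0# - b                      ≈⟨ +-congʳ (+-congˡ (-‿inverseʳ 1#)) ⟨
    a + (1# - 1#) - b               ≈⟨ +-congʳ (+-assoc a 1# (- 1#)) ⟨
    a + 1# - 1# - b                 ≈⟨ +-assoc (a + 1#) (- 1#) (- b) ⟩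
    a + 1# + (- 1# - b)             ≈⟨ +-cong (+-comm a 1#) (⁻¹-∙-comm 1# b) ⟩
    1# + a - (1# + b)               ≈⟨ +-cong (1+× m 1#) (-‿cong (1+× n 1#)) ⟨
    suc m ×ℕ 1# - suc n ×ℕ 1#         ∎
    where
    a = m ×ℕ 1#
    b = n ×ℕ 1#

  -ℤ-homo : ∀ i → ⟦ ℤ.- i ⟧ℤ ≈ - ⟦ i ⟧ℤ
  -ℤ-homo (+ zero)   = sym -0#≈0#
  -ℤ-homo (+ suc n)  = refl
  -ℤ-homo (-[1+ n ]) = sym (-‿involutive _)

  +ℤ-homo : ∀ i j → ⟦ i ℤ.+ j ⟧ℤ ≈ ⟦ i ⟧ℤ + ⟦ j ⟧ℤ
  +ℤ-homo (+ m)    (+ n)    = ×-homo-+ 1# m n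
  +ℤ-homo (+ m)    -[1+ n ] = ⊖-homo m (suc n)
  +ℤ-homo -[1+ m ] (+ n)    = trans (⊖-homo n (suc m)) (+-comm _ _)
  +ℤ-homo -[1+ m ] -[1+ n ] = begin
    - (suc (suc (m ℕ.+ n)) ×ℕ 1#)          ≡⟨ ≡.cong (λ k → - (suc k ×ℕ 1#)) (ℕP.+-suc m n) ⟨
    - ((suc m ℕ.+ suc n) ×ℕ 1#)            ≈⟨ -‿cong (×-homo-+ 1# (suc m) (suc n)) ⟩
    - (suc m ×ℕ 1# + suc n ×ℕ 1#)           ≈⟨ ⁻¹-∙-comm _ _ ⟨
    - (suc m ×ℕ 1#) - (suc n ×ℕ 1#)         ∎

  +*-homo : ∀ m j → ⟦ + m ℤ.* j ⟧ℤ ≈ m ×ℕ 1# * ⟦ j ⟧ℤ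
  +*-homo m (+ n) = trans (reflexive (≡.cong ⟦_⟧ℤ (≡.sym (ℤP.pos-* m n)))) (×1-homo-* m n)
  +*-homo m -[1+ n ] = begin
    ⟦ + m ℤ.* -[1+ n ] ⟧ℤ        ≡⟨ ≡.cong ⟦_⟧ℤ (ℤP.neg-distribʳ-* (+ m) (+ suc n)) ⟨
    ⟦ ℤ.- (+ m ℤ.* + suc n) ⟧ℤ   ≈⟨ -ℤ-homo (+ m ℤ.* + suc n) ⟩
    - ⟦ + m ℤ.* + suc n ⟧ℤ       ≈⟨ -‿cong (+*-homo m (+ suc n)) ⟩
    - (m ×ℕ 1# * (suc n ×ℕ 1#))    ≈⟨ -‿distribʳ-* _ _ ⟩
    m ×ℕ 1# * - (suc n ×ℕ 1#)      ∎

  *ℤ-homo : ∀ i j → ⟦ i ℤ.* j ⟧ℤ ≈ ⟦ i ⟧ℤ * ⟦ j ⟧ℤ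
  *ℤ-homo (+ m) j = +*-homo m j
  *ℤ-homo -[1+ m ] j = begin
    ⟦ -[1+ m ] ℤ.* j ⟧ℤ          ≡⟨ ≡.cong ⟦_⟧ℤ (ℤP.neg-distribˡ-* (+ suc m) j) ⟨
    ⟦ ℤ.- (+ suc m ℤ.* j) ⟧ℤ     ≈⟨ -ℤ-homo (+ suc m ℤ.* j) ⟩
    - ⟦ + suc m ℤ.* j ⟧ℤ         ≈⟨ -‿cong (+*-homo (suc m) j) ⟩
    - (suc m ×ℕ 1# * ⟦ j ⟧ℤ)      ≈⟨ -‿distribˡ-* _ _ ⟩
    - (suc m ×ℕ 1#) * ⟦ j ⟧ℤ      ∎

  ℤ⟶𝓡 : ℤ.+-*-rawRing -Raw-AlmostCommutative⟶ fromCommutativeRing 𝓡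
  ℤ⟶𝓡 = record
    { ⟦_⟧ = ⟦_⟧ℤ ; +-homo = +ℤ-homo ; *-homo = *ℤ-homo ; -‿homo = -ℤ-homo
    ; 0-homo = refl ; 1-homo = refl }

  ℤ-coefficient≟ : ∀ i j → Maybe (⟦ i ⟧ℤ ≈ ⟦ j ⟧ℤ)
  ℤ-coefficient≟ i j with i ℤP.≟ j
  ... | yes i≡j = just (reflexive (≡.cong ⟦_⟧ℤ i≡j))
  ... | no  _   = nothing

  open import Algebra.Solver.Ring ℤ.+-*-rawRing (fromCommutativeRing 𝓡) ℤ⟶𝓡 ℤ-coefficient≟ public
    using (solve; _:=_; con; _:+_; _:*_; _:-_; :-_)

  -- Reduces an equality modulo a hypothesis to an identity that the ring solver can check, with `k`
  -- as the cofactor of the relation. Nested uses handle several hypotheses, so a proof only has to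
  -- supply a certificate of ideal membership.
  x≈y+k[a-b]⇒x≈y : ∀ {x y a b} k → a ≈ b → x ≈ y + k * (a - b) → x ≈ y
  x≈y+k[a-b]⇒x≈y {x} {y} {a} {b} k a≈b eq = begin
    x                 ≈⟨ eq ⟩
    y + k * (a - b)   ≈⟨ +-congˡ (*-congˡ (trans (+-congʳ a≈b) (-‿inverseʳ b))) ⟩
    y + k * 0#        ≈⟨ +-congˡ (zeroʳ k) ⟩
    y + 0#            ≈⟨ +-identityʳ y ⟩
    y                 ∎

-- Continued fractions as matrices

-- Stands for ℚ[x] with ℤ[x] as its integral elements. The recursions never look at coefficients;
-- they need ring identities, closure of the integral elements and additivity of degrees.
-- `Deg-factor` replaces a test for zero: it provides degrees of cofactors that are known only
-- through a product.
record DegreeRing : Set₁ where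
  field
    commutativeRing : CommutativeRing 0ℓ 0ℓ
  open CommutativeRing commutativeRing public hiding (zero)
  field
    Int        : Carrier → Set
    Int-resp   : ∀ {p q} → p ≈ q → Int p → Int q
    Int-0      : Int 0#
    Int-1      : Int 1#
    Int-+      : ∀ {p q} → Int p → Int q → Int (p + q)
    Int-*      : ∀ {p q} → Int p → Int q → Int (p * q)
    Int-neg    : ∀ {p} → Int p → Int (- p)
    -- Below p n stands for deg p < n, so that 0# is below every n; 0# has no degree.
    Deg        : Carrier → ℕ → Set
    Below      : Carrier → ℕ → Set
    Deg-resp   : ∀ {p q n} → p ≈ q → Deg p n → Deg q n
    Deg-1      : Deg 1# 0
    Deg-*      : ∀ {p q m n} → Deg p m → Deg q n → Deg (p * q) (m ℕ.+ n)
    Deg-+      : ∀ {p q n} → Deg p n → Below q n → Deg (p + q) n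
    Deg-unique : ∀ {p m n} → Deg p m → Deg p n → m ≡ n
    Deg-factor : ∀ {p q n} → Deg (p * q) n → ∃ (Deg p)
    Below-resp : ∀ {p q n} → p ≈ q → Below p n → Below q n
    Below-0    : ∀ {n} → Below 0# n
    Below-≤    : ∀ {p m n} → m ℕ.≤ n → Below p m → Below p n
    Below-+    : ∀ {p q n} → Below p n → Below q n → Below (p + q) n
    Below-*    : ∀ {p q m n} → Deg p m → Below q n → Below (p * q) (m ℕ.+ n)
    Deg⇒Below  : ∀ {p m n} → Deg p m → m ℕ.< n → Below p n

module ContinuedFractions (𝓓 : DegreeRing) where
  open DegreeRing 𝓓
  open IntegerSolver commutativeRing

  private
    variable
      a D D' U U' R R' V V' p q ρ σ : Carrier
      m n k : ℕ

  -- In ℤ[x] these are the signs 1 and -1. As square roots of 1 they can be cancelled by the solver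
  -- through a single relation, without a case distinction.
  Unit : Carrier → Set
  Unit ρ = Int ρ × ρ * ρ ≈ 1#

  Unit-Deg : Unit ρ → Deg ρ 0
  Unit-Deg {ρ} (_ , ρρ≈1) with Deg-factor (Deg-resp (sym ρρ≈1) Deg-1)
  ... | m , degρ = ≡.subst (Deg ρ)
    (ℕP.m+n≡0⇒m≡0 m (Deg-unique (Deg-* degρ degρ) (Deg-resp (sym ρρ≈1) Deg-1))) degρ

  Unit-* : Unit ρ → Unit σ → Unit (ρ * σ)
  Unit-* {ρ} {σ} (Iρ , ρρ) (Iσ , σσ) = Int-* Iρ Iσ ,
    x≈y+k[a-b]⇒x≈y 1# σσ (x≈y+k[a-b]⇒x≈y (σ * σ) ρρ (solve 2 (λ ρ σ →
      ρ :* σ :* (ρ :* σ) := con (+ 1) :+ con (+ 1) :* (σ :* σ :- con (+ 1)) :+ σ :* σ :* (ρ :* ρ :- con (+ 1))) refl ρ σ))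

  Unit-1 : Unit 1#
  Unit-1 = Int-1 , *-identityˡ 1#

  Unit-neg : Unit ρ → Unit (- ρ)
  Unit-neg {ρ} (Iρ , ρρ) = Int-neg Iρ , trans (solve 1 (λ ρ → (:- ρ) :* (:- ρ) := ρ :* ρ) refl ρ) ρρ

  Unit-Deg-* : Unit ρ → Deg p n → Deg (ρ * p) n
  Unit-Deg-* uρ = Deg-* (Unit-Deg uρ)

  Unit-Below-* : Unit ρ → Below p n → Below (ρ * p) n
  Unit-Below-* uρ = Below-* (Unit-Deg uρ)

  -1*p : ∀ p → - 1# * p ≈ - p
  -1*p = solve 1 (λ p → (:- con (+ 1)) :* p := :- p) refl

  Deg-neg : Deg p n → Deg (- p) n
  Deg-neg degp = Deg-resp (-1*p _) (Unit-Deg-* (Unit-neg Unit-1) degp)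

  Below-neg : Below p n → Below (- p) n
  Below-neg belowp = Below-resp (-1*p _) (Unit-Below-* (Unit-neg Unit-1) belowp)

  Deg-cancel : Deg p m → Deg (p * q) (m ℕ.+ n) → Deg q n
  Deg-cancel {p} {m} {q} {n} degp degpq with Deg-factor (Deg-resp (*-comm p q) degpq)
  ... | k , degq = ≡.subst (Deg q) (ℕP.+-cancelˡ-≡ m k n (Deg-unique (Deg-* degp degq) degpq)) degq

  Int-minus : Int p → Int q → Int (p - q)
  Int-minus Ip Iq = Int-+ Ip (Int-neg Iq)

  -- CF D U R V : the matrix (D U ; R V) is a product of matrices (a 1 ; 1 0)
  -- whose entries a are integral and non-constant.
  data CF : (D U R V : Carrier) → Set where
    nil  : D ≈ 1# → U ≈ 0# → R ≈ 0# → V ≈ 1# → CF D U R V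
    cons : Int a → Deg a (suc k) → CF D U R V →
           D' ≈ a * D + R → U' ≈ a * U + V → R' ≈ D → V' ≈ U → CF D' U' R' V'

  CF-resp : D ≈ D' → U ≈ U' → R ≈ R' → V ≈ V' → CF D U R V → CF D' U' R' V'
  CF-resp d u r v (nil d₁ u₁ r₁ v₁) =
    nil (trans (sym d) d₁) (trans (sym u) u₁) (trans (sym r) r₁) (trans (sym v) v₁)
  CF-resp d u r v (cons Ia dega cf d₁ u₁ r₁ v₁) =
    cons Ia dega cf (trans (sym d) d₁) (trans (sym u) u₁) (trans (sym r) r₁) (trans (sym v) v₁)

  CF-single : Int a → Deg a (suc k) → CF a 1# 1# 0#
  CF-single {a} Ia dega = cons Ia dega (nil refl refl refl refl)
    (solve 1 (λ a → a := a :* con (+ 1) :+ con (+ 0)) refl a)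
    (solve 1 (λ a → con (+ 1) := a :* con (+ 0) :+ con (+ 1)) refl a) refl refl

  -- Associativity of the matrix product: the first factor `(a 1 ; 1 0)` can be taken out on the
  -- left.
  CF-append : CF D U R V → CF D' U' R' V' →
              CF (D * D' + U * R') (D * U' + U * V') (R * D' + V * R') (R * U' + V * V')
  CF-append {D' = D'} {U'} {R'} {V'} (nil d u r v) cf = CF-resp
    (sym (first d u)) (sym (first d u)) (sym (second r v)) (sym (second r v)) cf
    where
    first : ∀ {x y s t} → x ≈ 1# → y ≈ 0# → x * s + y * t ≈ s
    first {s = s} {t} x y = trans (+-cong (*-congʳ x) (*-congʳ y))
      (solve 2 (λ s t → con (+ 1) :* s :+ con (+ 0) :* t := s) refl s t)
    second : ∀ {x y s t} → x ≈ 0# → y ≈ 1# → x * s + y * t ≈ t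
    second {s = s} {t} x y = trans (+-cong (*-congʳ x) (*-congʳ y))
      (solve 2 (λ s t → con (+ 0) :* s :+ con (+ 1) :* t := t) refl s t)
  CF-append {D' = D'} {U'} {R'} {V'} (cons {a = a} {D = D} {U} {R} {V} Ia dega cf d u r v) cf' =
    cons Ia dega (CF-append cf cf') (upper D' R') (upper U' V') (lower D' R') (lower U' V')
    where
    upper : ∀ s t → _
    upper s t = trans (+-cong (*-congʳ {s} d) (*-congʳ {t} u))
      (solve 7 (λ a D U R V s t → (a :* D :+ R) :* s :+ (a :* U :+ V) :* t
         := a :* (D :* s :+ U :* t) :+ (R :* s :+ V :* t)) refl a D U R V s t)
    lower : ∀ s t → _
    lower s t = +-cong (*-congʳ {s} r) (*-congʳ {t} v)

  CF-snoc : CF D U R V → Int a → Deg a (suc k) → CF (D * a + U) D (R * a + V) R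
  CF-snoc {D} {U} {R} {V} {a} cf Ia dega =
    CF-resp (left D U) (right D U) (left R V) (right R V) (CF-append cf (CF-single Ia dega))
    where
    left : ∀ x y → x * a + y * 1# ≈ x * a + y
    left x y = +-congˡ (*-identityʳ y)
    right : ∀ x y → x * 1# + y * 0# ≈ x
    right = solve 2 (λ x y → x :* con (+ 1) :+ y :* con (+ 0) := x) refl

  det : (D U R V : Carrier) → Carrier
  det D U R V = D * V - R * U

  CF-Int : CF D U R V → Int D × Int U × Int R × Int V
  CF-Int (nil d u r v) = Int-resp (sym d) Int-1 , Int-resp (sym u) Int-0 , Int-resp (sym r) Int-0 , Int-resp (sym v) Int-1
  CF-Int (cons Ia _ cf d u r v) with CF-Int cf
  ... | ID , IU , IR , IV = Int-resp (sym d) (Int-+ (Int-* Ia ID) IR) , Int-resp (sym u) (Int-+ (Int-* Ia IU) IV)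
      , Int-resp (sym r) ID , Int-resp (sym v) IU

  det² : CF D U R V → det D U R V * det D U R V ≈ 1#
  det² (nil d u r v) = trans (*-cong eq eq) (*-identityˡ 1#)
    where eq = trans (+-cong (*-cong d v) (-‿cong (*-cong r u)))
                 (solve 0 (con (+ 1) :* con (+ 1) :- con (+ 0) :* con (+ 0) := con (+ 1)) refl)
  det² (cons {a = a} {D = D} {U} {R} {V} _ _ cf d u r v) = trans (*-cong eq eq)
    (trans (solve 1 (λ δ → (:- δ) :* (:- δ) := δ :* δ) refl (det D U R V)) (det² cf))
    where eq = trans (+-cong (*-cong d v) (-‿cong (*-cong r u)))
                 (solve 5 (λ a D U R V → (a :* D :+ R) :* U :- D :* (a :* U :+ V) := :- (D :* V :- R :* U)) refl a D U R V)

  Unit-det : CF D U R V → Unit (det D U R V)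
  Unit-det cf with CF-Int cf
  ... | ID , IU , IR , IV = Int-minus (Int-* ID IV) (Int-* IR IU) , det² cf

  record Degrees (D U R V : Carrier) : Set where
    field
      degree : ℕ
      Deg-D   : Deg D degree
      Below-U : Below U degree
      Below-R : Below R degree
      -- For the empty word `V` and `D` are both 1, hence a bound one weaker than for `U` and `R`.
      Below-V : Below V (suc degree)

  CF-Degrees : CF D U R V → Degrees D U R V
  CF-Degrees (nil d u r v) = record
    { degree = 0 ; Deg-D = Deg-resp (sym d) Deg-1 ; Below-U = Below-resp (sym u) Below-0
    ; Below-R = Below-resp (sym r) Below-0 ; Below-V = Below-resp (sym v) (Deg⇒Below Deg-1 ℕP.≤-refl) }
  CF-Degrees (cons {k = k} _ dega cf d u r v) = record
    { degree  = suc k ℕ.+ degree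
    ; Deg-D   = Deg-resp (sym d) (Deg-+ (Deg-* dega Deg-D) (Below-≤ (ℕP.m≤n+m degree (suc k)) Below-R))
    ; Below-U = Below-resp (sym u) (Below-+ (Below-* dega Below-U) (Below-≤ (ℕP.+-monoˡ-≤ degree (ℕ.s≤s ℕ.z≤n)) Below-V))
    ; Below-R = Below-resp (sym r) (Deg⇒Below Deg-D (ℕ.s≤s (ℕP.m≤n+m degree k)))
    ; Below-V = Below-resp (sym v) (Below-≤ (ℕP.≤-trans (ℕP.m≤n+m degree (suc k)) (ℕP.n≤1+n _)) Below-U) }
    where open Degrees (CF-Degrees cf)

  -- If M belongs to the word w, then ± (D -R ; -U V) belongs to the reversal
  -- of w with all signs changed.
  CF-fold : CF D U R V → ∃ λ σ → Unit σ × CF (σ * D) (- (σ * R)) (- (σ * U)) (σ * V)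
  CF-fold (nil d u r v) = 1# , Unit-1 , nil (trans (*-identityˡ _) d) (neg r) (neg u) (trans (*-identityˡ _) v)
    where
    neg : ∀ {x} → x ≈ 0# → - (1# * x) ≈ 0#
    neg x = trans (-‿cong (*-congˡ x)) (solve 0 (:- (con (+ 1) :* con (+ 0)) := con (+ 0)) refl)
  CF-fold (cons {a = a} {D = D} {U} {R} {V} Ia dega cf d u r v) with CF-fold cf
  ... | σ , uσ , cf' = - σ , Unit-neg uσ ,
    CF-resp
      (trans (solve 4 (λ σ a D R → σ :* D :* (:- a) :+ :- (σ :* R) := (:- σ) :* (a :* D :+ R)) refl σ a D R) (*-congˡ (sym d)))
      (trans (solve 2 (λ σ D → σ :* D := :- ((:- σ) :* D)) refl σ D) (-‿cong (*-congˡ (sym r))))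
      (trans (solve 4 (λ σ a U V → (:- (σ :* U)) :* (:- a) :+ σ :* V := :- ((:- σ) :* (a :* U :+ V))) refl σ a U V) (-‿cong (*-congˡ (sym u))))
      (trans (solve 2 (λ σ U → :- (σ :* U) := (:- σ) :* U) refl σ U) (*-congˡ (sym v)))
      (CF-snoc cf' (Int-neg Ia) (Deg-neg dega))

-- The four recursions

module Products (𝓓 : DegreeRing) where
  open DegreeRing 𝓓
  open IntegerSolver commutativeRing
  open ContinuedFractions 𝓓

  prod : (ℕ → Carrier) → ℕ → Carrier
  prod e zero    = e zero
  prod e (suc n) = prod e n * e (suc n)

  module Sequence
    (τ : Carrier) (Unit-τ : Unit τ) (e : ℕ → Carrier) (Int-e : ∀ n → Int (e n))
    (μ : ℕ → ℕ) (Deg-e : ∀ n → Deg (e n) (suc (μ n)))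
    where

    e' : ℕ → Carrier
    e' n = e n + τ

    -- The quotient of the two products is `1 + τ R / D`, so the word of `cf` expands it up to its
    -- constant term and the sign `τ`; `u` collects what cancels.
    record Expansion (n : ℕ) : Set where
      field
        {D U R V} : Carrier
        u   : Carrier
        cf  : CF D U R V
        ∏e  : prod e n ≈ u * D
        ∏e' : prod e' n ≈ u * (D + τ * R)

    Int-τ : Int τ
    Int-τ = proj₁ Unit-τ

    ττ≈1 : τ * τ ≈ 1#
    ττ≈1 = proj₂ Unit-τ

    Int-e' : ∀ n → Int (e' n)
    Int-e' n = Int-+ (Int-e n) Int-τ

    Deg-e' : ∀ n → Deg (e' n) (suc (μ n))
    Deg-e' n = Deg-+ (Deg-e n) (Deg⇒Below (Unit-Deg Unit-τ) (ℕ.s≤s ℕ.z≤n))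

    Int-2τ : Int (τ + τ)
    Int-2τ = Int-+ Int-τ Int-τ

    Deg-H : ∀ {D R s} → Deg D s → Below R s → Deg (D + τ * R) s
    Deg-H degD belowR = Deg-+ degD (Unit-Below-* Unit-τ belowR)

    Deg-D-from-H : ∀ {D U R V ρ n} → CF D U R V → Unit ρ → D + τ * R ≈ ρ * e' n → Deg D (suc (μ n))
    Deg-D-from-H {D} {n = n} cf uρ H≈ = ≡.subst (Deg D)
      (Deg-unique (Deg-resp H≈ (Deg-H Deg-D Below-R)) (Unit-Deg-* uρ (Deg-e' n))) Deg-D
      where open Degrees (CF-Degrees cf)

    cf₀ : CF (e 0) 1# 1# 0#
    cf₀ = CF-single (Int-e 0) (Deg-e 0)

    ∏e₀ : e 0 ≈ 1# * e 0
    ∏e₀ = sym (*-identityˡ _)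

    H₀ : e 0 + τ * 1# ≈ 1# * e' 0
    H₀ = solve 2 (λ e τ → e :+ τ :* con (+ 1) := con (+ 1) :* (e :+ τ)) refl (e 0) τ

    ∏e'₀ : e' 0 ≈ 1# * (e 0 + τ * 1#)
    ∏e'₀ = solve 2 (λ e τ → e :+ τ := con (+ 1) :* (e :+ τ :* con (+ 1))) refl (e 0) τ

    -- Cases (i) and (iii).
    module Folding
      (g : ℕ → Carrier) (Int-g : ∀ n → Int (g n)) (Deg-g : ∀ n → ∃ (Deg (g n)))
      (e-suc : ∀ n → e (suc n) ≈ e n * e n * e' n * g n)
      where

      -- `H≈` lets `D + τ R` cancel the factor `e' n` of `e (suc n)`, and `DE≈` makes the remaining
      -- factor `e n * e n` divisible by `D`. These are the two divisions in the formula for the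
      -- next partial quotient.
      record State (n : ℕ) : Set where
        field
          {D U R V} : Carrier
          u ρ E : Carrier
          cf  : CF D U R V
          Unit-ρ : Unit ρ
          Int-E  : Int E
          H≈  : D + τ * R ≈ ρ * e' n
          DE≈ : D * E ≈ e n * e n
          ∏e  : prod e n ≈ u * D
          ∏e' : prod e' n ≈ u * (D + τ * R)

      state₀ : State 0
      state₀ = record
        { u = 1# ; ρ = 1# ; E = e 0 ; cf = cf₀ ; Unit-ρ = Unit-1 ; Int-E = Int-e 0
        ; H≈ = H₀ ; DE≈ = refl ; ∏e = ∏e₀ ; ∏e' = ∏e'₀ }

      next : ∀ {n} → State n → State (suc n)
      next {n} s with CF-fold (State.cf s)
      ... | σ , Unit-σ , cfσ = record
        { u = u * (D + τ * R) * ρ⁺ ; ρ = ρ⁺ ; E = w * E * (y' * y') * γ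
        ; cf = CF-append (CF-snoc cf Int-q Deg-q) cfσ
        ; Unit-ρ = Unit-ρ⁺
        ; Int-E = Int-* (Int-* (Int-* (proj₁ Unit-w) Int-E) (Int-* (Int-e' n) (Int-e' n))) (Int-g n)
        ; H≈ = H⁺≈ ; DE≈ = D⁺E⁺≈ ; ∏e = ∏e⁺ ; ∏e' = ∏e'⁺ }
        where
        open State s
        γ = g n
        y = e n
        y' = e' n
        δ = det D U R V
        Unit-δ = Unit-det cf
        ρ⁺ = σ * δ
        Unit-ρ⁺ = Unit-* Unit-σ Unit-δ
        w = ρ⁺ * ρ
        Unit-w = Unit-* Unit-ρ⁺ Unit-ρ
        -- Appending q and the folded word adds `δ / (D² q)` to `R / D`, and the increment has to be
        -- `(D + τ R) / (D e (suc n))`. Hence `q = δ e (suc n) / (D (D + τ R))`, which is this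
        -- product by `H≈` and `DE≈`.
        q = δ * ρ * (E * γ)
        Int-q = Int-* (Int-* (proj₁ Unit-δ) (proj₁ Unit-ρ)) (Int-* Int-E (Int-g n))
        Deg-E : Deg E (suc (μ n))
        Deg-E = Deg-cancel (Deg-D-from-H cf Unit-ρ H≈) (Deg-resp (sym DE≈) (Deg-* (Deg-e n) (Deg-e n)))
        Deg-q : Deg q (suc (μ n) ℕ.+ proj₁ (Deg-g n))
        Deg-q = Unit-Deg-* (Unit-* Unit-δ Unit-ρ) (Deg-* Deg-E (proj₂ (Deg-g n)))
        D⁺ = (D * q + U) * (σ * D) + D * - (σ * U)
        R⁺ = (R * q + V) * (σ * D) + R * - (σ * U)
        D⁺≈ : D⁺ ≈ w * γ * D * (y * y)
        D⁺≈ = x≈y+k[a-b]⇒x≈y _ DE≈ (solve 8 (λ σ δ ρ g D E U y →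
          (D :* (δ :* ρ :* (E :* g)) :+ U) :* (σ :* D) :+ D :* :- (σ :* U) :=
          σ :* δ :* ρ :* g :* D :* (y :* y) :+ σ :* δ :* ρ :* g :* D :* (D :* E :- y :* y)) refl σ δ ρ γ D E U y)
        H⁺≈ : D⁺ + τ * R⁺ ≈ ρ⁺ * e' (suc n)
        H⁺≈ = trans
          (x≈y+k[a-b]⇒x≈y _ DE≈ (x≈y+k[a-b]⇒x≈y _ H≈ (x≈y+k[a-b]⇒x≈y _ (proj₂ Unit-ρ)
            -- The solver treats `δ` as a variable. Its definition enters as the trivial relation
            -- `δ ≈ δ`, whose left side is spelled out as `D V - R U` in the certificate.
            (x≈y+k[a-b]⇒x≈y (σ * τ) (refl {δ})
            (solve 12 (λ σ δ ρ g D E R V U τ y y' →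
              (D :* (δ :* ρ :* (E :* g)) :+ U) :* (σ :* D) :+ D :* :- (σ :* U) :+
                τ :* ((R :* (δ :* ρ :* (E :* g)) :+ V) :* (σ :* D) :+ R :* :- (σ :* U)) :=
              σ :* δ :* (y :* y :* y' :* g :+ τ)
              :+ σ :* δ :* ρ :* g :* (D :+ τ :* R) :* (D :* E :- y :* y)
              :+ σ :* δ :* ρ :* g :* (y :* y) :* (D :+ τ :* R :- ρ :* y')
              :+ σ :* δ :* g :* (y :* y) :* y' :* (ρ :* ρ :- con (+ 1))
              :+ σ :* τ :* (D :* V :- R :* U :- δ)) refl σ δ ρ γ D E R V U τ y y')))))
          (*-congˡ (+-congʳ (sym (e-suc n))))
        D⁺E⁺≈ : D⁺ * (w * E * (y' * y') * γ) ≈ e (suc n) * e (suc n)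
        D⁺E⁺≈ = trans (*-congʳ D⁺≈) (trans
          (x≈y+k[a-b]⇒x≈y _ DE≈ (x≈y+k[a-b]⇒x≈y _ (proj₂ Unit-w) (solve 6 (λ w g D E y y' →
            w :* g :* D :* (y :* y) :* (w :* E :* (y' :* y') :* g) :=
            y :* y :* y' :* g :* (y :* y :* y' :* g)
            :+ w :* w :* g :* g :* y' :* y' :* y :* y :* (D :* E :- y :* y)
            :+ g :* g :* y' :* y' :* y :* y :* y :* y :* (w :* w :- con (+ 1))) refl w γ D E y y')))
          (*-cong (sym (e-suc n)) (sym (e-suc n))))
        ∏e⁺ : prod e n * e (suc n) ≈ u * (D + τ * R) * ρ⁺ * D⁺
        ∏e⁺ = trans (*-cong ∏e (e-suc n)) (sym (trans (*-congˡ D⁺≈)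
          (x≈y+k[a-b]⇒x≈y _ H≈ (x≈y+k[a-b]⇒x≈y _ (proj₂ Unit-w) (solve 8 (λ u H r ρ g D y y' →
            u :* H :* r :* (r :* ρ :* g :* D :* (y :* y)) :=
            u :* D :* (y :* y :* y' :* g)
            :+ u :* r :* (r :* ρ) :* g :* D :* y :* y :* (H :- ρ :* y')
            :+ u :* y' :* g :* D :* y :* y :* (r :* ρ :* (r :* ρ) :- con (+ 1))) refl u (D + τ * R) ρ⁺ ρ γ D y y')))))
        ∏e'⁺ : prod e' n * e' (suc n) ≈ u * (D + τ * R) * ρ⁺ * (D⁺ + τ * R⁺)
        ∏e'⁺ = trans (*-congʳ ∏e') (sym (trans (*-congˡ H⁺≈)
          (x≈y+k[a-b]⇒x≈y _ (proj₂ Unit-ρ⁺) (solve 4 (λ u H r z →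
            u :* H :* r :* (r :* z) := u :* H :* z :+ u :* H :* z :* (r :* r :- con (+ 1)))
            refl u (D + τ * R) ρ⁺ (e' (suc n))))))

      state : ∀ n → State n
      state zero    = state₀
      state (suc n) = next (state n)

      expansion : ∀ n → Expansion n
      expansion n = record { State (state n) }

    -- Cases (iv) and (v).
    module Palindromic
      (g : ℕ → Carrier) (Int-g : ∀ n → Int (g n)) (Deg-g : ∀ n → ∃ (Deg (g n)))
      (e-suc : ∀ n → e (suc n) ≈ e' n * ((e' n * e' n - 1#) * g n - (τ + τ) * e' n))
      where

      -- The repeated `R` encodes the symmetry of the matrix, that is, a palindromic word. `DE≈` is
      -- the divisibility behind the next q; its right side factors as `e (e + 2 τ)`, which explains
      -- the initial `E`.
      record State (n : ℕ) : Set where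
        field
          {D R V} : Carrier
          u ρ E : Carrier
          cf  : CF D R R V
          det≈ : D * V - R * R ≈ - 1#
          Unit-ρ : Unit ρ
          Int-E  : Int E
          H≈  : D + τ * R ≈ ρ * e' n
          DE≈ : D * E ≈ e' n * e' n - 1#
          ∏e  : prod e n ≈ u * D
          ∏e' : prod e' n ≈ u * (D + τ * R)

      state₀ : State 0
      state₀ = record
        { u = 1# ; ρ = 1# ; E = e 0 + (τ + τ) ; cf = cf₀
        ; det≈ = solve 1 (λ e → e :* con (+ 0) :- con (+ 1) :* con (+ 1) := :- con (+ 1)) refl (e 0)
        ; Unit-ρ = Unit-1 ; Int-E = Int-+ (Int-e 0) Int-2τ
        ; H≈ = H₀
        ; DE≈ = sym (x≈y+k[a-b]⇒x≈y _ ττ≈1 (solve 2 (λ e τ → (e :+ τ) :* (e :+ τ) :- con (+ 1) :=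
            e :* (e :+ (τ :+ τ)) :+ con (+ 1) :* (τ :* τ :- con (+ 1))) refl (e 0) τ))
        ; ∏e = ∏e₀ ; ∏e' = ∏e'₀ }

      next : ∀ {n} → State n → State (suc n)
      next {n} s = record
        { u = - (u * (D + τ * R)) ; ρ = - 1# ; E = - (ρ * y' * E * (γ * y' - (τ + τ)))
        ; cf = CF-resp refl symmetric refl refl (CF-append (CF-snoc cf Int-q Deg-q) cf)
        ; det≈ = det⁺≈
        ; Unit-ρ = Unit-neg Unit-1
        ; Int-E = Int-neg (Int-* (Int-* (Int-* (proj₁ Unit-ρ) (Int-e' n)) Int-E)
                    (Int-minus (Int-* (Int-g n) (Int-e' n)) Int-2τ))
        ; H≈ = H⁺≈ ; DE≈ = D⁺E⁺≈ ; ∏e = ∏e⁺ ; ∏e' = ∏e'⁺ }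
        where
        open State s
        γ = g n
        y' = e' n
        h = (y' * y' - 1#) * γ - (τ + τ) * y'
        -- The word (w, q, w) changes `R / D` by `-1 / (D (D q + 2 R))`, so `D q + 2 R` has to be
        -- `- e (suc n) / (D + τ R)`, that is `- ρ h`. Since `2 R = 2 τ (ρ y' - D)`, the summand
        -- `- 2 τ y'` of `h` is exactly what makes `- ρ h - 2 R` a multiple of `D`.
        q = (τ + τ) - ρ * (E * γ)
        Int-q = Int-minus Int-2τ (Int-* (proj₁ Unit-ρ) (Int-* Int-E (Int-g n)))
        Deg-E : Deg E (suc (μ n))
        Deg-E = Deg-cancel (Deg-D-from-H cf Unit-ρ H≈) (Deg-resp (sym DE≈)
          (Deg-+ (Deg-* (Deg-e' n) (Deg-e' n)) (Deg⇒Below (Deg-neg Deg-1) (ℕ.s≤s ℕ.z≤n))))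
        Deg-q : Deg q (suc (μ n) ℕ.+ proj₁ (Deg-g n))
        Deg-q = Deg-resp (+-comm _ _)
          (Deg-+ (Deg-neg (Unit-Deg-* Unit-ρ (Deg-* Deg-E (proj₂ (Deg-g n))))) (Below-+ Below-τ Below-τ))
          where Below-τ = Deg⇒Below (Unit-Deg Unit-τ) (ℕ.s≤s ℕ.z≤n)
        D⁺ = (D * q + R) * D + D * R
        R⁺ = (R * q + V) * D + R * R
        V⁺ = (R * q + V) * R + R * V
        symmetric : (D * q + R) * R + D * V ≈ R⁺
        symmetric = solve 4 (λ D R V q → (D :* q :+ R) :* R :+ D :* V := (R :* q :+ V) :* D :+ R :* R) refl D R V q
        det⁺≈ : D⁺ * V⁺ - R⁺ * R⁺ ≈ - 1#
        det⁺≈ = x≈y+k[a-b]⇒x≈y _ det≈ (solve 4 (λ D R V q →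
          ((D :* q :+ R) :* D :+ D :* R) :* ((R :* q :+ V) :* R :+ R :* V) :-
            ((R :* q :+ V) :* D :+ R :* R) :* ((R :* q :+ V) :* D :+ R :* R) :=
          :- con (+ 1) :+ (con (+ 1) :- (D :* V :- R :* R)) :* (D :* V :- R :* R :- :- con (+ 1))) refl D R V q)
        κ≈ : D * q + R + R ≈ - (ρ * h)
        κ≈ = x≈y+k[a-b]⇒x≈y _ H≈ (x≈y+k[a-b]⇒x≈y _ ττ≈1 (x≈y+k[a-b]⇒x≈y _ DE≈ (solve 7 (λ D R E τ ρ g y' →
          D :* ((τ :+ τ) :- ρ :* (E :* g)) :+ R :+ R :=
          :- (ρ :* ((y' :* y' :- con (+ 1)) :* g :- (τ :+ τ) :* y'))
          :+ (τ :+ τ) :* (D :+ τ :* R :- ρ :* y')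
          :+ (:- R :- R) :* (τ :* τ :- con (+ 1))
          :+ (:- (ρ :* g)) :* (D :* E :- (y' :* y' :- con (+ 1)))) refl D R E τ ρ γ y')))
        D⁺≈ : D⁺ ≈ - (ρ * (D * h))
        D⁺≈ = x≈y+k[a-b]⇒x≈y D κ≈ (solve 5 (λ D R q ρ h →
          (D :* q :+ R) :* D :+ D :* R :=
          :- (ρ :* (D :* h)) :+ D :* (D :* q :+ R :+ R :- :- (ρ :* h))) refl D R q ρ h)
        H⁺≈ : D⁺ + τ * R⁺ ≈ - 1# * e' (suc n)
        H⁺≈ = trans
          (x≈y+k[a-b]⇒x≈y _ κ≈ (x≈y+k[a-b]⇒x≈y _ H≈ (x≈y+k[a-b]⇒x≈y _ (proj₂ Unit-ρ) (x≈y+k[a-b]⇒x≈y _ det≈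
            (solve 8 (λ D R V q τ ρ h y' →
              (D :* q :+ R) :* D :+ D :* R :+ τ :* ((R :* q :+ V) :* D :+ R :* R) :=
              (:- con (+ 1)) :* (y' :* h :+ τ)
              :+ (D :+ τ :* R) :* (D :* q :+ R :+ R :- :- (ρ :* h))
              :+ (:- (ρ :* h)) :* (D :+ τ :* R :- ρ :* y')
              :+ (:- (y' :* h)) :* (ρ :* ρ :- con (+ 1))
              :+ τ :* (D :* V :- R :* R :- :- con (+ 1))) refl D R V q τ ρ h y')))))
          (*-congˡ (+-congʳ (sym (e-suc n))))
        -- The cofactor comes from writing `e' (suc n)` as `y' h + τ`: its square minus 1 is
        -- `y' h (y' h + 2 τ)`, and `y' h + 2 τ = (y'² - 1) (γ y' - 2 τ)`, where `y'² - 1` is `D E`.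
        D⁺E⁺≈ : D⁺ * - (ρ * y' * E * (γ * y' - (τ + τ))) ≈ e' (suc n) * e' (suc n) - 1#
        D⁺E⁺≈ = trans (*-congʳ D⁺≈) (trans
          (x≈y+k[a-b]⇒x≈y _ DE≈ (x≈y+k[a-b]⇒x≈y _ (proj₂ Unit-ρ) (x≈y+k[a-b]⇒x≈y _ ττ≈1
            (solve 6 (λ D E τ ρ g y' → let h = (y' :* y' :- con (+ 1)) :* g :- (τ :+ τ) :* y' in
              (:- (ρ :* (D :* h))) :* :- (ρ :* y' :* E :* (g :* y' :- (τ :+ τ))) :=
              ((y' :* h :+ τ) :* (y' :* h :+ τ) :- con (+ 1))
              :+ ρ :* ρ :* h :* y' :* (g :* y' :- (τ :+ τ)) :* (D :* E :- (y' :* y' :- con (+ 1)))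
              :+ h :* y' :* (g :* y' :- (τ :+ τ)) :* (y' :* y' :- con (+ 1)) :* (ρ :* ρ :- con (+ 1))
              :+ (:- con (+ 1)) :* (τ :* τ :- con (+ 1))) refl D E τ ρ γ y'))))
          (+-congʳ (*-cong (+-congʳ (sym (e-suc n))) (+-congʳ (sym (e-suc n))))))
        ∏e⁺ : prod e n * e (suc n) ≈ - (u * (D + τ * R)) * D⁺
        ∏e⁺ = trans (*-cong ∏e (e-suc n)) (sym (trans (*-congˡ D⁺≈)
          (x≈y+k[a-b]⇒x≈y _ H≈ (x≈y+k[a-b]⇒x≈y _ (proj₂ Unit-ρ) (solve 6 (λ u H ρ D h y' →
            (:- (u :* H)) :* (:- (ρ :* (D :* h))) :=
            u :* D :* (y' :* h)
            :+ u :* ρ :* D :* h :* (H :- ρ :* y')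
            :+ u :* D :* (y' :* h) :* (ρ :* ρ :- con (+ 1))) refl u (D + τ * R) ρ D h y')))))
        ∏e'⁺ : prod e' n * e' (suc n) ≈ - (u * (D + τ * R)) * (D⁺ + τ * R⁺)
        ∏e'⁺ = trans (*-congʳ ∏e') (sym (trans (*-congˡ H⁺≈)
          (solve 2 (λ x z → (:- x) :* ((:- con (+ 1)) :* z) := x :* z) refl (u * (D + τ * R)) (e' (suc n)))))

      state : ∀ n → State n
      state zero    = state₀
      state (suc n) = next (state n)

      expansion : ∀ n → Expansion n
      expansion n = record { State (state n) }

    -- Cases (vi) and (vii).
    module TwoTerm
      (g : ℕ → Carrier) (Int-g : ∀ n → Int (g n))
      (e-suc : ∀ n → e (suc n) ≈ e n * e n * ((e n * e n - 1#) * g n + τ))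
      (μ-suc : ∀ n → suc (μ n) ℕ.+ (suc (μ n) ℕ.+ suc (μ n)) ℕ.≤ suc (μ (suc n)))
      where

      -- By the recursion, `e n * e n` divides `e (suc n)` and `e n * e n - 1` divides
      -- `e (suc n) - τ`. So `DY≈` and `HX≈` make `D` and `D + τ R` divisors of two polynomials that
      -- differ by the unit `τ`.
      record State (n : ℕ) : Set where
        field
          {D U R V} : Carrier
          {d} : ℕ
          u Y X : Carrier
          cf  : CF D U R V
          Deg-D : Deg D (suc d)
          -- The next q has degree `deg e (suc n) - 2 deg D`, which must be positive. The bound
          -- persists because `deg D` grows by `deg e (suc n)` while the degree of `e` at least
          -- triples.
          d-bound : suc d ℕ.+ suc d ℕ.≤ μ (suc n)
          Int-Y : Int Y
          Int-X : Int X
          DY≈ : D * Y ≈ e n * e n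
          HX≈ : (D + τ * R) * X ≈ e n * e n - 1#
          ∏e  : prod e n ≈ u * D
          ∏e' : prod e' n ≈ u * (D + τ * R)

      state₀ : State 0
      state₀ = record
        { u = 1# ; Y = e 0 ; X = e 0 - τ ; cf = cf₀
        ; Deg-D = Deg-e 0
        ; d-bound = ℕP.≤-pred (ℕP.≤-trans (ℕP.+-monoˡ-≤ (suc (μ 0) ℕ.+ suc (μ 0)) (ℕ.s≤s (ℕ.z≤n {μ 0}))) (μ-suc 0))
        ; Int-Y = Int-e 0 ; Int-X = Int-minus (Int-e 0) Int-τ
        ; DY≈ = refl
        ; HX≈ = x≈y+k[a-b]⇒x≈y _ ττ≈1 (solve 2 (λ e τ → (e :+ τ :* con (+ 1)) :* (e :- τ) :=
            e :* e :- con (+ 1) :+ (:- con (+ 1)) :* (τ :* τ :- con (+ 1))) refl (e 0) τ)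
        ; ∏e = ∏e₀ ; ∏e' = ∏e'₀ }

      next : ∀ {n} → State n → State (suc n)
      next {n} s = record
        { u = τ * u ; Y = τ * Z₁ ; X = τ * Z₂
        ; cf = CF-snoc (CF-snoc cf Int-q Deg-q) Int-b Deg-b
        ; Deg-D = Deg-resp (sym D⁺≈) (Unit-Deg-* Unit-τ (Deg-* Deg-D (Deg-e (suc n))))
        ; d-bound = ℕP.≤-pred (ℕP.≤-trans d-bound⁺ (μ-suc (suc n)))
        ; Int-Y = Int-* Int-τ Int-Z₁ ; Int-X = Int-* Int-τ Int-Z₂
        ; DY≈ = D⁺Y⁺≈ ; HX≈ = H⁺X⁺≈ ; ∏e = ∏e⁺ ; ∏e' = ∏e'⁺ }
        where
        open State s
        γ = g n
        y = e n
        ζ = e (suc n)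
        H = D + τ * R
        δ = det D U R V
        Unit-δ = Unit-det cf
        Int-D = proj₁ (CF-Int cf)
        Int-U = proj₁ (proj₂ (CF-Int cf))
        Int-R = proj₁ (proj₂ (proj₂ (CF-Int cf)))
        Int-V = proj₂ (proj₂ (proj₂ (CF-Int cf)))
        Int-yy = Int-* (Int-e n) (Int-e n)
        Z₁ = Y * ((y * y - 1#) * γ + τ)
        Int-Z₁ = Int-* Int-Y (Int-+ (Int-* (Int-minus Int-yy Int-1) (Int-g n)) Int-τ)
        Z₂ = X * (y * y * γ + τ)
        Int-Z₂ = Int-* Int-X (Int-+ (Int-* Int-yy (Int-g n)) Int-τ)
        DZ₁≈ : D * Z₁ ≈ ζ
        DZ₁≈ = trans (sym (*-assoc _ _ _)) (trans (*-congʳ DY≈) (sym (e-suc n)))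
        HZ₂≈ : H * Z₂ ≈ ζ - τ
        HZ₂≈ = trans (sym (*-assoc _ _ _)) (trans (*-congʳ HX≈) (trans
          (solve 3 (λ y g τ → (y :* y :- con (+ 1)) :* (y :* y :* g :+ τ) :=
             y :* y :* ((y :* y :- con (+ 1)) :* g :+ τ) :- τ) refl y γ τ)
          (+-congʳ (sym (e-suc n)))))
        -- A Bezout combination: `δ = D (V + τ U) - τ H U`, while `D` divides `ζ` with quotient `Z₁`
        -- and `H` divides `ζ - τ` with quotient `Z₂`. Therefore `D H` divides `δ (ζ - τ) - H U`,
        -- and this is the quotient.
        q = (V + τ * U) * Z₂ - τ * U * Z₁
        Int-q = Int-minus (Int-* (Int-+ Int-V (Int-* Int-τ Int-U)) Int-Z₂) (Int-* (Int-* Int-τ Int-U) Int-Z₁)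
        DHq≈ : D * H * q ≈ δ * (ζ - τ) - H * U
        DHq≈ = x≈y+k[a-b]⇒x≈y _ HZ₂≈ (x≈y+k[a-b]⇒x≈y _ DZ₁≈ (x≈y+k[a-b]⇒x≈y _ ττ≈1
          (x≈y+k[a-b]⇒x≈y (ζ - τ) (refl {δ}) (solve 9 (λ D U R V τ Z₁ Z₂ δ ζ → let H = D :+ τ :* R in
            D :* H :* ((V :+ τ :* U) :* Z₂ :- τ :* U :* Z₁) :=
            (δ :* (ζ :- τ) :- H :* U)
            :+ D :* (V :+ τ :* U) :* (H :* Z₂ :- (ζ :- τ))
            :+ (:- (τ :* U :* H)) :* (D :* Z₁ :- ζ)
            :+ (:- (R :* U :* (ζ :- τ)) :- H :* U) :* (τ :* τ :- con (+ 1))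
            :+ (ζ :- τ) :* (D :* V :- R :* U :- δ)) refl D U R V τ Z₁ Z₂ δ ζ))))
        Deg-DH : Deg (D * H) (suc d ℕ.+ suc d)
        Deg-DH with CF-Degrees cf
        ... | r = Deg-* Deg-D (Deg-H Deg-D (≡.subst (Below R) (Deg-unique (Degrees.Deg-D r) Deg-D) (Degrees.Below-R r)))
        Below-HU : Below (H * U) (suc d ℕ.+ suc d)
        Below-HU with CF-Degrees cf
        ... | r = Below-*
          (Deg-H Deg-D (≡.subst (Below R) (Deg-unique (Degrees.Deg-D r) Deg-D) (Degrees.Below-R r)))
          (≡.subst (Below U) (Deg-unique (Degrees.Deg-D r) Deg-D) (Degrees.Below-U r))
        Deg-q : Deg q (suc (μ (suc n) ℕ.∸ (suc d ℕ.+ suc d)))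
        Deg-q = Deg-cancel Deg-DH (≡.subst (Deg (D * H * q)) (≡.sym degree≡) (Deg-resp (sym DHq≈)
          (Deg-+ (Unit-Deg-* Unit-δ (Deg-+ (Deg-e (suc n)) (Below-neg (Deg⇒Below (Unit-Deg Unit-τ) (ℕ.s≤s ℕ.z≤n)))))
                 (Below-neg (Below-≤ (ℕP.≤-trans d-bound (ℕP.n≤1+n _)) Below-HU)))))
          where
          degree≡ : suc d ℕ.+ suc d ℕ.+ suc (μ (suc n) ℕ.∸ (suc d ℕ.+ suc d)) ≡ suc (μ (suc n))
          degree≡ = ≡.trans (ℕP.+-suc (suc d ℕ.+ suc d) _) (≡.cong suc (ℕP.m+[n∸m]≡n d-bound))
        -- The terms q, b change `R / D` by `δ b / (D D⁺)`, which has to equal `H / (D ζ)`, so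
        -- `D⁺ = δ b ζ / H`. For this `b` that is `τ D ζ`, and the only condition left on `q` is
        -- `DHq≈`.
        b = τ * δ * (D * H)
        Int-b = Int-* (Int-* Int-τ (proj₁ Unit-δ)) (Int-* Int-D (Int-+ Int-D (Int-* Int-τ Int-R)))
        Deg-b : Deg b (suc d ℕ.+ suc d)
        Deg-b = Unit-Deg-* (Unit-* Unit-τ Unit-δ) Deg-DH
        d-bound⁺ : suc (suc d ℕ.+ suc (μ (suc n)) ℕ.+ (suc d ℕ.+ suc (μ (suc n)))) ℕ.≤
                   suc (μ (suc n)) ℕ.+ (suc (μ (suc n)) ℕ.+ suc (μ (suc n)))
        d-bound⁺ = ℕP.≤-trans (ℕP.≤-reflexive (arith (suc d) (suc (μ (suc n)))))
          (ℕP.+-monoˡ-≤ (suc (μ (suc n)) ℕ.+ suc (μ (suc n))) (ℕ.s≤s d-bound))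
          where
          arith : ∀ d m → suc (d ℕ.+ m ℕ.+ (d ℕ.+ m)) ≡ suc (d ℕ.+ d) ℕ.+ (m ℕ.+ m)
          arith = ℕS.solve 2 (λ d m → ℕS.con 1 ℕS.:+ (d ℕS.:+ m ℕS.:+ (d ℕS.:+ m)) ℕS.:=
            ℕS.con 1 ℕS.:+ (d ℕS.:+ d) ℕS.:+ (m ℕS.:+ m)) ≡.refl
        D⁺ = (D * q + U) * b + D
        R⁺ = (R * q + V) * b + R
        D⁺≈ : D⁺ ≈ τ * (D * ζ)
        D⁺≈ = x≈y+k[a-b]⇒x≈y _ DHq≈ (x≈y+k[a-b]⇒x≈y _ (det² cf) (x≈y+k[a-b]⇒x≈y _ ττ≈1
          (solve 7 (λ D H U q τ δ ζ →
            (D :* q :+ U) :* (τ :* δ :* (D :* H)) :+ D :=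
            τ :* (D :* ζ)
            :+ τ :* δ :* D :* (D :* H :* q :- (δ :* (ζ :- τ) :- H :* U))
            :+ τ :* D :* (ζ :- τ) :* (δ :* δ :- con (+ 1))
            :+ (:- D) :* (τ :* τ :- con (+ 1))) refl D H U q τ δ ζ)))
        H⁺≈ : D⁺ + τ * R⁺ ≈ τ * (H * (ζ + τ))
        H⁺≈ = x≈y+k[a-b]⇒x≈y _ DHq≈ (x≈y+k[a-b]⇒x≈y _ (det² cf) (x≈y+k[a-b]⇒x≈y _ ττ≈1
          (x≈y+k[a-b]⇒x≈y (τ * δ * τ * H) (refl {δ}) (solve 8 (λ D U R V q τ δ ζ → let H = D :+ τ :* R ; b = τ :* δ :* (D :* H) in
            (D :* q :+ U) :* b :+ D :+ τ :* ((R :* q :+ V) :* b :+ R) :=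
            τ :* (H :* (ζ :+ τ))
            :+ τ :* δ :* H :* (D :* H :* q :- (δ :* (ζ :- τ) :- H :* U))
            :+ (τ :* H :* (ζ :- τ) :+ τ :* τ :* H) :* (δ :* δ :- con (+ 1))
            :+ (:- H) :* (τ :* τ :- con (+ 1))
            :+ τ :* δ :* τ :* H :* (D :* V :- R :* U :- δ)) refl D U R V q τ δ ζ))))
        D⁺Y⁺≈ : D⁺ * (τ * Z₁) ≈ ζ * ζ
        D⁺Y⁺≈ = trans (*-congʳ D⁺≈) (x≈y+k[a-b]⇒x≈y _ DZ₁≈ (x≈y+k[a-b]⇒x≈y _ ττ≈1 (solve 4 (λ D τ Z₁ ζ →
          τ :* (D :* ζ) :* (τ :* Z₁) :=
          ζ :* ζ :+ τ :* τ :* ζ :* (D :* Z₁ :- ζ) :+ ζ :* ζ :* (τ :* τ :- con (+ 1))) refl D τ Z₁ ζ)))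
        H⁺X⁺≈ : (D⁺ + τ * R⁺) * (τ * Z₂) ≈ ζ * ζ - 1#
        H⁺X⁺≈ = trans (*-congʳ H⁺≈) (x≈y+k[a-b]⇒x≈y _ HZ₂≈ (x≈y+k[a-b]⇒x≈y _ ττ≈1 (solve 4 (λ H τ Z₂ ζ →
          τ :* (H :* (ζ :+ τ)) :* (τ :* Z₂) :=
          ζ :* ζ :- con (+ 1) :+ τ :* τ :* (ζ :+ τ) :* (H :* Z₂ :- (ζ :- τ))
          :+ (ζ :* ζ :- τ :* τ :- con (+ 1)) :* (τ :* τ :- con (+ 1))) refl H τ Z₂ ζ)))
        ττ-insert : ∀ x z → u * x * z ≈ τ * u * (τ * (x * z))
        ττ-insert x z = sym (x≈y+k[a-b]⇒x≈y _ ττ≈1 (solve 4 (λ u τ x z →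
          τ :* u :* (τ :* (x :* z)) := u :* x :* z :+ u :* x :* z :* (τ :* τ :- con (+ 1))) refl u τ x z))
        ∏e⁺ : prod e n * ζ ≈ τ * u * D⁺
        ∏e⁺ = trans (*-congʳ ∏e) (trans (ττ-insert D ζ) (*-congˡ (sym D⁺≈)))
        ∏e'⁺ : prod e' n * (ζ + τ) ≈ τ * u * (D⁺ + τ * R⁺)
        ∏e'⁺ = trans (*-congʳ ∏e') (trans (ττ-insert H (ζ + τ)) (*-congˡ (sym H⁺≈)))

      state : ∀ n → State n
      state zero    = state₀
      state (suc n) = next (state n)

      expansion : ∀ n → Expansion n
      expansion n = record { State (state n) }

    -- Case (ii).
    module OneTerm
      -- At `n = 0` both `U` and `U + τ V` are 1, so the first new partial quotient is `g 0` up to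
      -- sign and `g 0` has to be non-constant.
      (g : ℕ → Carrier) (Int-g : ∀ n → Int (g n)) (ν : ℕ → ℕ) (Deg-g : ∀ n → Deg (g n) (suc (ν n)))
      (e-suc : ∀ n → e (suc n) ≈ e' n * (e n * g n - 1#))
      where

      -- Subtracting `e≈` from `e'≈` gives `τ = - ρ τ (D V - R U)`: the unit `ρ` is minus the
      -- determinant, and changes sign with each new term.
      record State (n : ℕ) : Set where
        field
          {D U R V} : Carrier
          u ρ : Carrier
          cf  : CF D U R V
          Unit-ρ : Unit ρ
          e'≈ : e' n ≈ ρ * (D + τ * R) * U
          e≈  : e n ≈ ρ * (U + τ * V) * D
          ∏e  : prod e n ≈ u * D
          ∏e' : prod e' n ≈ u * (D + τ * R)

      state₀ : State 0
      state₀ = record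
        { u = 1# ; ρ = 1# ; cf = cf₀ ; Unit-ρ = Unit-1
        ; e'≈ = solve 2 (λ e τ → e :+ τ := con (+ 1) :* (e :+ τ :* con (+ 1)) :* con (+ 1)) refl (e 0) τ
        ; e≈ = solve 2 (λ e τ → e := con (+ 1) :* (con (+ 1) :+ τ :* con (+ 0)) :* e) refl (e 0) τ
        ; ∏e = ∏e₀ ; ∏e' = ∏e'₀ }

      next : ∀ {n} → State n → State (suc n)
      next {n} s = record
        { u = - (ρ * u * H * D) ; ρ = - ρ ; cf = CF-snoc cf Int-q Deg-q ; Unit-ρ = Unit-neg Unit-ρ
        ; e'≈ = e'⁺≈ ; e≈ = e⁺≈ ; ∏e = ∏e⁺ ; ∏e' = ∏e'⁺ }
        where
        open State s
        γ = g n
        H = D + τ * R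
        K = U + τ * V
        Int-U = proj₁ (proj₂ (CF-Int cf))
        Int-V = proj₂ (proj₂ (proj₂ (CF-Int cf)))
        -- One new term changes `R / D` by `δ / (D D⁺)`, with `δ` the determinant, so `D⁺ = D q + U`
        -- has to be `δ e (suc n) / H`. As `δ ρ = -1`, `e'≈` turns this into `U (1 - e n γ)`, and
        -- `e≈` shows `e n γ U` to be the multiple `ρ γ U K` of `D`.
        q = - (ρ * (γ * (U * K)))
        Int-q = Int-neg (Int-* (proj₁ Unit-ρ) (Int-* (Int-g n) (Int-* Int-U (Int-+ Int-U (Int-* Int-τ Int-V)))))
        Deg-U : ∃ (Deg U)
        Deg-U = Deg-factor (Deg-resp (trans e'≈ (*-comm _ _)) (Deg-e' n))
        Deg-K : ∃ (Deg K)
        Deg-K = Deg-factor (Deg-resp (trans e≈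
          (solve 3 (λ ρ K D → ρ :* K :* D := K :* (ρ :* D)) refl ρ K D)) (Deg-e n))
        Deg-q : Deg q (suc (ν n) ℕ.+ (proj₁ Deg-U ℕ.+ proj₁ Deg-K))
        Deg-q = Deg-neg (Unit-Deg-* Unit-ρ (Deg-* (Deg-g n) (Deg-* (proj₂ Deg-U) (proj₂ Deg-K))))
        D⁺ = D * q + U
        R⁺ = R * q + V
        e⁺≈ : e (suc n) ≈ - ρ * (D + τ * R) * D⁺
        e⁺≈ = trans (e-suc n) (trans (*-cong e'≈ (+-congʳ (*-congʳ e≈))) (solve 6 (λ ρ H U K D g →
          ρ :* H :* U :* (ρ :* K :* D :* g :- con (+ 1)) :=
          (:- ρ) :* H :* (D :* :- (ρ :* (g :* (U :* K))) :+ U)) refl ρ H U K D γ))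
        e'⁺≈ : e' (suc n) ≈ - ρ * (D⁺ + τ * R⁺) * D
        e'⁺≈ = trans (+-congʳ (e-suc n)) (trans
          (solve 3 (λ y τ g → (y :+ τ) :* (y :* g :- con (+ 1)) :+ τ := y :* ((y :+ τ) :* g :- con (+ 1))) refl (e n) τ γ)
          (trans (*-cong e≈ (+-congʳ (*-congʳ e'≈))) (solve 7 (λ ρ D U R V τ g →
            let H = D :+ τ :* R ; K = U :+ τ :* V ; q = :- (ρ :* (g :* (U :* K))) in
            ρ :* K :* D :* (ρ :* H :* U :* g :- con (+ 1)) :=
            (:- ρ) :* (D :* q :+ U :+ τ :* (R :* q :+ V)) :* D) refl ρ D U R V τ γ)))
        ∏e⁺ : prod e n * e (suc n) ≈ - (ρ * u * H * D) * D⁺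
        ∏e⁺ = trans (*-cong ∏e e⁺≈) (solve 5 (λ u D ρ H x →
          u :* D :* ((:- ρ) :* H :* x) := (:- (ρ :* u :* H :* D)) :* x) refl u D ρ H D⁺)
        ∏e'⁺ : prod e' n * e' (suc n) ≈ - (ρ * u * H * D) * (D⁺ + τ * R⁺)
        ∏e'⁺ = trans (*-cong ∏e' e'⁺≈) (solve 5 (λ u D ρ H x →
          u :* H :* ((:- ρ) :* x :* D) := (:- (ρ :* u :* H :* D)) :* x) refl u D ρ H (D⁺ + τ * R⁺))

      state : ∀ n → State n
      state zero    = state₀
      state (suc n) = next (state n)

      expansion : ∀ n → Expansion n
      expansion n = record { State (state n) }

-- Evaluation of integer polynomials

module TopCoefficient {A : Set} (0# : A) (_⊕_ _⊗_ : A → A → A) (_≟_ : (x y : A) → Dec (x ≡ y)) where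
  open PolyOps 0# _⊕_ _⊗_

  Top : Poly → ℕ → Set
  Top p n = ¬ coeff p n ≡ 0# × (∀ k → n ℕ.< k → coeff p k ≡ 0#)

  zero-or-Top : ∀ p → IsZeroP p ⊎ ∃ (Top p)
  zero-or-Top [] = inj₁ (λ _ → ≡.refl)
  zero-or-Top (a ∷ p) with zero-or-Top p
  ... | inj₂ (n , ne , z) = inj₂ (suc n , ne , λ { (suc k) (ℕ.s≤s lt) → z k lt })
  ... | inj₁ z with a ≟ 0#
  ...   | yes a≡0 = inj₁ λ { zero → a≡0 ; (suc k) → z k }
  ...   | no  a≢0 = inj₂ (0 , a≢0 , λ { (suc k) _ → z k })

  NonZero⇒Top : ∀ p → NonZeroP p → ∃ (Top p)
  NonZero⇒Top p (k , ne) with zero-or-Top p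
  ... | inj₁ z   = ⊥-elim (ne (z k))
  ... | inj₂ deg = deg

module ℤTop = TopCoefficient (+ 0) ℤ._+_ ℤ._*_ ℤP._≟_

DegAtLeast3⇒Top : ∀ f → DegAtLeast3 f → ∃ λ d → ℤTop.Top f (suc (suc (suc d)))
DegAtLeast3⇒Top f (k , 3≤k , ne) with ℤTop.NonZero⇒Top f (k , ne)
... | d , ne' , z with ℕP.≤-trans 3≤k (ℕP.≮⇒≥ (λ d<k → ne (z k d<k)))
...   | ℕ.s≤s (ℕ.s≤s (ℕ.s≤s {n = d'} _)) = d' , ne' , z

record Scalars (𝓓 : DegreeRing) : Set where
  open DegreeRing 𝓓
  field
    ι     : ℤ → Carrier
    ι-+   : ∀ i j → ι (i ℤ.+ j) ≈ ι i + ι j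
    ι-*   : ∀ i j → ι (i ℤ.* j) ≈ ι i * ι j
    ι-0   : ι (+ 0) ≈ 0#
    ι-1   : ι (+ 1) ≈ 1#
    Int-ι : ∀ i → Int (ι i)
    Deg-ι : ∀ {i} → ¬ i ≡ + 0 → Deg (ι i) 0

module Evaluation (𝓓 : DegreeRing) (𝓢 : Scalars 𝓓) where
  open DegreeRing 𝓓
  open Scalars 𝓢
  open IntegerSolver commutativeRing
  open Z using (_+ₚ_; _*ₚ_; scale)

  ev : Carrier → ZPoly → Carrier
  ev y []      = 0#
  ev y (a ∷ p) = ι a + y * ev y p

  ev-Int : ∀ {y} → Int y → ∀ p → Int (ev y p)
  ev-Int Iy []      = Int-0
  ev-Int Iy (a ∷ p) = Int-+ (Int-ι a) (Int-* Iy (ev-Int Iy p))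

  ev-0 : ∀ y p → Z.IsZeroP p → ev y p ≈ 0#
  ev-0 y []      z = refl
  ev-0 y (a ∷ p) z = trans (+-cong (trans (reflexive (≡.cong ι (z 0))) ι-0) (*-congˡ (ev-0 y p (λ k → z (suc k)))))
    (solve 1 (λ y → con (+ 0) :+ y :* con (+ 0) := con (+ 0)) refl y)

  ev-cong : ∀ y p q → p Z.≈ q → ev y p ≈ ev y q
  ev-cong y []      q       eq = sym (ev-0 y q (λ k → ≡.sym (eq k)))
  ev-cong y (a ∷ p) []      eq = ev-0 y (a ∷ p) eq
  ev-cong y (a ∷ p) (b ∷ q) eq =
    +-cong (reflexive (≡.cong ι (eq 0))) (*-congˡ (ev-cong y p q (λ k → eq (suc k))))

  ev-+ : ∀ y p q → ev y (p +ₚ q) ≈ ev y p + ev y q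
  ev-+ y []      q       = sym (+-identityˡ _)
  ev-+ y (a ∷ p) []      = sym (+-identityʳ _)
  ev-+ y (a ∷ p) (b ∷ q) = trans (+-cong (ι-+ a b) (*-congˡ (ev-+ y p q)))
    (solve 5 (λ y a b p q → a :+ b :+ y :* (p :+ q) := a :+ y :* p :+ (b :+ y :* q)) refl y (ι a) (ι b) (ev y p) (ev y q))

  ev-scale : ∀ y a p → ev y (scale a p) ≈ ι a * ev y p
  ev-scale y a []      = sym (zeroʳ _)
  ev-scale y a (b ∷ p) = trans (+-cong (ι-* a b) (*-congˡ (ev-scale y a p)))
    (solve 4 (λ y a b p → a :* b :+ y :* (a :* p) := a :* (b :+ y :* p)) refl y (ι a) (ι b) (ev y p))

  ev-* : ∀ y p q → ev y (p *ₚ q) ≈ ev y p * ev y q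
  ev-* y []      q = sym (zeroˡ _)
  ev-* y (a ∷ p) q = trans (ev-+ y (scale a q) (+ 0 ∷ p *ₚ q))
    (trans (+-cong (ev-scale y a q) (+-cong ι-0 (*-congˡ (ev-* y p q))))
      (solve 4 (λ y a p q → a :* q :+ (con (+ 0) :+ y :* (p :* q)) := (a :+ y :* p) :* q) refl y (ι a) (ev y p) (ev y q)))

  ι-neg : ∀ i → ι (ℤ.- i) ≈ - ι i
  ι-neg i = x≈y+k[a-b]⇒x≈y _ (trans (sym (ι-+ i (ℤ.- i))) (trans (reflexive (≡.cong ι (ℤP.+-inverseʳ i))) ι-0))
    (solve 2 (λ x y → y := :- x :+ con (+ 1) :* (x :+ y :- con (+ 0))) refl (ι i) (ι (ℤ.- i)))

  ev-minus : ∀ y p q → ev y (p -z q) ≈ ev y p - ev y q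
  ev-minus y p q = trans (ev-+ y p (scale (ℤ.- (+ 1)) q)) (+-congˡ (trans (ev-scale y (ℤ.- (+ 1)) q)
    (trans (*-congʳ (trans (ι-neg (+ 1)) (-‿cong ι-1)))
      (solve 1 (λ x → (:- con (+ 1)) :* x := :- x) refl (ev y q)))))

  ev-cz : ∀ y i → ev y (cz i) ≈ ι i
  ev-cz y i = trans (+-congˡ (zeroʳ y)) (+-identityʳ _)

  -- A record keeps `y`, `p` and `v` inferable, whereas `ev y p` may compute and hide `p`. The
  -- combinators mirror the syntax of `Form`, so that each case is evaluated by a term of its own
  -- shape.
  record _⊢_↦_ (y : Carrier) (p : ZPoly) (v : Carrier) : Set where
    constructor mk↦
    field ev≈ : ev y p ≈ v
  open _⊢_↦_ public

  private
    variable
      y v w : Carrier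
      p q : ZPoly

  infixl 7 _⟨*⟩_
  infixl 6 _⟨+⟩_ _⟨-⟩_

  _⟨+⟩_ : y ⊢ p ↦ v → y ⊢ q ↦ w → y ⊢ p +ₚ q ↦ (v + w)
  _⟨+⟩_ {y} {p} {q = q} (mk↦ eq) (mk↦ eq') = mk↦ (trans (ev-+ y p q) (+-cong eq eq'))

  _⟨*⟩_ : y ⊢ p ↦ v → y ⊢ q ↦ w → y ⊢ p *ₚ q ↦ (v * w)
  _⟨*⟩_ {y} {p} {q = q} (mk↦ eq) (mk↦ eq') = mk↦ (trans (ev-* y p q) (*-cong eq eq'))

  _⟨-⟩_ : y ⊢ p ↦ v → y ⊢ q ↦ w → y ⊢ p -z q ↦ (v - w)
  _⟨-⟩_ {y} {p} {q = q} (mk↦ eq) (mk↦ eq') = mk↦ (trans (ev-minus y p q) (+-cong eq (-‿cong eq')))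

  ⟨_⟩ : ∀ p → y ⊢ p ↦ ev y p
  ⟨ p ⟩ = mk↦ refl

  ⟨1⟩ : y ⊢ cz (+ 1) ↦ 1#
  ⟨1⟩ = mk↦ (trans (ev-cz _ (+ 1)) ι-1)

  ⟨2⟩ : y ⊢ cz (+ 2) ↦ (1# + 1#)
  ⟨2⟩ = mk↦ (trans (ev-cz _ (+ 2)) (trans (ι-+ (+ 1) (+ 1)) (+-cong ι-1 ι-1)))

  ⟨X⟩ : y ⊢ Xz ↦ y
  ⟨X⟩ {y} = mk↦ (trans (+-cong ι-0 (*-congˡ (ev≈ (⟨1⟩ {y})))) (trans (+-identityˡ _) (*-identityʳ y)))

  -- Horner's scheme: since `y` is non-constant, `y` times a non-zero value has positive degree, and
  -- the constant coefficient cannot disturb the leading term.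
  Deg-ev : ∀ {y m} p d → Deg y (suc m) → ℤTop.Top p d → Deg (ev y p) (d ℕ.* suc m)
  Deg-ev []      d       Dy (ne , z) = ⊥-elim (ne ≡.refl)
  Deg-ev {y} (a ∷ p) zero Dy (ne , z) = Deg-+ (Deg-ι ne)
    (Below-resp (sym (trans (*-congˡ (ev-0 y p (λ k → z (suc k) (ℕ.s≤s ℕ.z≤n)))) (zeroʳ y))) Below-0)
  Deg-ev {y} (a ∷ p) (suc d) Dy (ne , z) = Deg-resp (+-comm _ _)
    (Deg-+ (Deg-* Dy (Deg-ev p d Dy (ne , λ k lt → z (suc k) (ℕ.s≤s lt)))) Below-ι)
    where
    Below-ι : ∀ {n} → Below (ι a) (suc n)
    Below-ι with a ℤP.≟ + 0
    ... | yes ≡.refl = Below-resp (sym ι-0) Below-0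
    ... | no  a≢0    = Deg⇒Below (Deg-ι a≢0) (ℕ.s≤s ℕ.z≤n)

-- The orbit of f and the seven forms

module Convergents (𝓓 : DegreeRing) (𝓢 : Scalars 𝓓) where
  open DegreeRing 𝓓
  open IntegerSolver commutativeRing
  open ContinuedFractions 𝓓
  open Products 𝓓
  open Evaluation 𝓓 𝓢

  -- num / den = a + R / P in unreduced form, where R / P = [0; a₁, a₂, …].
  record Convergent (num den : Carrier) : Set where
    field
      {P U R V} : Carrier
      u a   : Carrier
      Int-a : Int a
      cf    : CF P U R V
      num≈  : num ≈ u * (a * P + R)
      den≈  : den ≈ u * P

  Convergent₊ : ∀ {D U R V num den} u → CF D U R V → den ≈ u * D → num ≈ u * (D + 1# * R) → Convergent num den
  Convergent₊ {D} {R = R} u cf den≈ num≈ = record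
    { u = u ; a = 1# ; Int-a = Int-1 ; cf = cf ; den≈ = den≈
    ; num≈ = trans num≈ (solve 3 (λ u D R → u :* (D :+ con (+ 1) :* R) := u :* (con (+ 1) :* D :+ R)) refl u D R) }

  -- If R / D = [0; a₁, a₂, …] then D / (D - R) = [1; a₁ - 1, a₂, …].
  Convergent₋ : ∀ {D U R V num den} u → CF D U R V → num ≈ u * D → den ≈ u * (D + - 1# * R) → Convergent num den
  Convergent₋ u (nil d _ r _) num≈ den≈ = record
    { u = u ; a = 1# ; Int-a = Int-1 ; cf = nil {1#} {0#} {0#} {1#} refl refl refl refl
    ; num≈ = trans num≈ (trans (*-congˡ d) (solve 1 (λ u → u :* con (+ 1) := u :* (con (+ 1) :* con (+ 1) :+ con (+ 0))) refl u))
    ; den≈ = trans den≈ (trans (*-congˡ (+-cong d (*-congˡ r)))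
        (solve 1 (λ u → u :* (con (+ 1) :+ (:- con (+ 1)) :* con (+ 0)) := u :* con (+ 1)) refl u)) }
  Convergent₋ u (cons {a = a} {D = P} {R = R} Ia dega cf d _ r _) num≈ den≈ = record
    { u = u ; a = 1# ; Int-a = Int-1
    ; cf = cons {a = a - 1#} (Int-minus Ia Int-1) (Deg-+ dega (Below-neg (Deg⇒Below Deg-1 (ℕ.s≤s ℕ.z≤n)))) cf refl refl refl refl
    ; num≈ = trans num≈ (trans (*-congˡ d)
        (solve 4 (λ u a P R → u :* (a :* P :+ R) := u :* (con (+ 1) :* ((a :- con (+ 1)) :* P :+ R) :+ P)) refl u a P R))
    ; den≈ = trans den≈ (trans (*-congˡ (+-cong d (*-congˡ r)))
        (solve 4 (λ u a P R → u :* (a :* P :+ R :+ (:- con (+ 1)) :* P) := u :* ((a :- con (+ 1)) :* P :+ R)) refl u a P R)) }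

  prod-cong : ∀ {e e' : ℕ → Carrier} → (∀ n → e n ≈ e' n) → ∀ n → prod e n ≈ prod e' n
  prod-cong eq zero    = eq 0
  prod-cong eq (suc n) = *-cong (prod-cong eq n) (eq (suc n))

  module Orbit
    (f G g : ZPoly) (f≥3 : DegAtLeast3 f) (G≢0 : Z.NonZeroP G) (g≢0 : Z.NonZeroP g)
    (y : ℕ → Carrier) (y-suc : ∀ n → y (suc n) ≈ ev (y n) f) (Int-y₀ : Int (y 0)) (Deg-y₀ : Deg (y 0) 1)
    where

    f-top : ∃ λ d → ℤTop.Top f (suc (suc (suc d)))
    f-top = DegAtLeast3⇒Top f f≥3

    -- One less than the degree of `f`, so that `suc d' * suc (μ n)` computes to `suc (μ (suc n))`,
    -- as `Deg-y` needs.
    d' : ℕ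
    d' = suc (suc (proj₁ f-top))

    -- suc (μ n) is the degree of y n, namely (deg f)ⁿ.
    μ : ℕ → ℕ
    μ zero    = 0
    μ (suc n) = μ n ℕ.+ d' ℕ.* suc (μ n)

    Int-y : ∀ n → Int (y n)
    Int-y zero    = Int-y₀
    Int-y (suc n) = Int-resp (sym (y-suc n)) (ev-Int (Int-y n) f)

    Deg-y : ∀ n → Deg (y n) (suc (μ n))
    Deg-y zero    = Deg-y₀
    Deg-y (suc n) = Deg-resp (sym (y-suc n)) (Deg-ev f (suc d') (Deg-y n) (proj₂ f-top))

    μ-suc : ∀ n → suc (μ n) ℕ.+ (suc (μ n) ℕ.+ suc (μ n)) ℕ.≤ suc (μ (suc n))
    μ-suc n = ℕP.+-monoʳ-≤ (suc (μ n)) (ℕP.+-monoʳ-≤ (suc (μ n)) (ℕP.m≤m+n (suc (μ n)) _))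

    y₊ : ℕ → Carrier
    y₊ n = y n + 1#

    Int-y₊ : ∀ n → Int (y₊ n)
    Int-y₊ n = Int-+ (Int-y n) Int-1

    Deg-y₊ : ∀ n → Deg (y₊ n) (suc (μ n))
    Deg-y₊ n = Deg-+ (Deg-y n) (Deg⇒Below Deg-1 (ℕ.s≤s ℕ.z≤n))

    γ : ℕ → Carrier
    γ n = ev (y n) g

    Int-γ : ∀ n → Int (γ n)
    Int-γ n = ev-Int (Int-y n) g

    Deg-γ : ∀ n → ∃ (Deg (γ n))
    Deg-γ n with ℤTop.NonZero⇒Top g g≢0
    ... | k , g-top = _ , Deg-ev g k (Deg-y n) g-top

    module Plus = Sequence 1# Unit-1 y Int-y μ Deg-y
    module Minus = Sequence (- 1#) (Unit-neg Unit-1) y₊ Int-y₊ μ Deg-y₊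

    fromPlus : ∀ {n} → Plus.Expansion n → Convergent (prod y₊ n) (prod y n)
    fromPlus x = Convergent₊ u cf ∏e ∏e'
      where open Plus.Expansion x

    fromMinus : ∀ {n} → Minus.Expansion n → Convergent (prod y₊ n) (prod y n)
    fromMinus {n} x = Convergent₋ u cf ∏e (trans (prod-cong y≈ n) ∏e')
      where
      open Minus.Expansion x
      y≈ : ∀ n → y n ≈ y₊ n + - 1#
      y≈ n = solve 1 (λ y → y := y :+ con (+ 1) :- con (+ 1)) refl (y n)

    step-form : ∀ {p} n {v} → f Z.≈ p → y n ⊢ p ↦ v → y (suc n) ≈ v
    step-form {p} n f≈p p↦v = trans (y-suc n) (trans (ev-cong (y n) f p f≈p) (ev≈ p↦v))

    Γ : ℕ → Carrier
    Γ n = ev (y n) G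

    Γ-suc : f Z.≈ Xz Z.*ₚ (Xz Z.+ₚ cz (+ 1)) Z.*ₚ G -z Xz -z cz (+ 1) →
            ∀ n → y (suc n) ≈ y₊ n * (y n * Γ n - 1#)
    Γ-suc eq n = trans (step-form n eq (⟨X⟩ ⟨*⟩ (⟨X⟩ ⟨+⟩ ⟨1⟩) ⟨*⟩ ⟨ G ⟩ ⟨-⟩ ⟨X⟩ ⟨-⟩ ⟨1⟩))
      (solve 2 (λ y G → y :* (y :+ con (+ 1)) :* G :- y :- con (+ 1) :=
        (y :+ con (+ 1)) :* (y :* G :- con (+ 1))) refl (y n) (Γ n))

    -- If G were constant, f would have degree at most two.
    Deg-Γ : (∀ n → y (suc n) ≈ y₊ n * (y n * Γ n - 1#)) → ∃ λ (ν : ℕ → ℕ) → ∀ n → Deg (Γ n) (suc (ν n))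
    Deg-Γ eq with ℤTop.NonZero⇒Top G G≢0
    ... | suc k , G-top = (λ n → μ n ℕ.+ k ℕ.* suc (μ n)) , λ n → Deg-ev G (suc k) (Deg-y n) G-top
    ... | zero  , G-top = ⊥-elim (2≢3+ (Deg-unique Deg-y₁ (Deg-y 1)))
      where
      Deg-y₁ : Deg (y 1) 2
      Deg-y₁ = Deg-resp (sym (eq 0)) (Deg-* (Deg-y₊ 0) (Deg-+ (Deg-* Deg-y₀ (Deg-ev G 0 Deg-y₀ G-top))
        (Below-neg (Deg⇒Below Deg-1 (ℕ.s≤s ℕ.z≤n)))))
      2≢3+ : ∀ {n} → ¬ 2 ≡ suc (suc (suc n))
      2≢3+ ()

    convergent : Form f G g → ∀ n → Convergent (prod y₊ n) (prod y n)
    convergent (inj₁ eq) n = fromPlus (Plus.Folding.expansion γ Int-γ Deg-γ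
      (λ n → step-form n eq (⟨X⟩ ⟨*⟩ ⟨X⟩ ⟨*⟩ (⟨X⟩ ⟨+⟩ ⟨1⟩) ⟨*⟩ ⟨ g ⟩)) n)
    convergent (inj₂ (inj₁ eq)) n = fromPlus (Plus.OneTerm.expansion Γ (λ n → ev-Int (Int-y n) G)
      (proj₁ (Deg-Γ (Γ-suc eq))) (proj₂ (Deg-Γ (Γ-suc eq))) (Γ-suc eq) n)
    convergent (inj₂ (inj₂ (inj₁ eq))) n = fromMinus (Minus.Folding.expansion γ Int-γ Deg-γ
      (λ n → trans (+-congʳ (step-form n eq (⟨X⟩ ⟨*⟩ (⟨X⟩ ⟨+⟩ ⟨1⟩) ⟨*⟩ (⟨X⟩ ⟨+⟩ ⟨1⟩) ⟨*⟩ ⟨ g ⟩ ⟨-⟩ ⟨1⟩)))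
        (solve 2 (λ y g → y :* (y :+ con (+ 1)) :* (y :+ con (+ 1)) :* g :- con (+ 1) :+ con (+ 1) :=
          (y :+ con (+ 1)) :* (y :+ con (+ 1)) :* (y :+ con (+ 1) :+ :- con (+ 1)) :* g) refl (y n) (γ n))) n)
    convergent (inj₂ (inj₂ (inj₂ (inj₁ eq)))) n = fromMinus (Minus.Palindromic.expansion γ Int-γ Deg-γ
      (λ n → trans (+-congʳ (step-form n eq
          (⟨X⟩ ⟨*⟩ (⟨X⟩ ⟨+⟩ ⟨1⟩) ⟨*⟩ ((⟨X⟩ ⟨-⟩ ⟨1⟩) ⟨*⟩ ⟨ g ⟩ ⟨+⟩ ⟨2⟩) ⟨-⟩ ⟨2⟩ ⟨*⟩ ⟨X⟩ ⟨-⟩ ⟨1⟩)))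
        (solve 2 (λ y g → let e' = y :+ con (+ 1) :+ :- con (+ 1) in
          y :* (y :+ con (+ 1)) :* ((y :- con (+ 1)) :* g :+ (con (+ 1) :+ con (+ 1)))
            :- (con (+ 1) :+ con (+ 1)) :* y :- con (+ 1) :+ con (+ 1) :=
          e' :* ((e' :* e' :- con (+ 1)) :* g :- ((:- con (+ 1)) :+ (:- con (+ 1))) :* e')) refl (y n) (γ n))) n)
    convergent (inj₂ (inj₂ (inj₂ (inj₂ (inj₁ eq))))) n = fromPlus (Plus.Palindromic.expansion γ Int-γ Deg-γ
      (λ n → trans (step-form n eq
          (⟨X⟩ ⟨*⟩ (⟨X⟩ ⟨+⟩ ⟨1⟩) ⟨*⟩ ((⟨X⟩ ⟨+⟩ ⟨2⟩) ⟨*⟩ ⟨ g ⟩ ⟨-⟩ ⟨2⟩) ⟨-⟩ ⟨2⟩ ⟨*⟩ ⟨X⟩ ⟨-⟩ ⟨2⟩))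
        (solve 2 (λ y g → let 1:2 = con (+ 1) :+ con (+ 1) ; e' = y :+ con (+ 1) in
          y :* (y :+ con (+ 1)) :* ((y :+ 1:2) :* g :- 1:2) :- 1:2 :* y :- 1:2 :=
          e' :* ((e' :* e' :- con (+ 1)) :* g :- 1:2 :* e')) refl (y n) (γ n))) n)
    convergent (inj₂ (inj₂ (inj₂ (inj₂ (inj₂ (inj₁ eq)))))) n = fromPlus (Plus.TwoTerm.expansion γ Int-γ
      (λ n → trans (step-form n eq
          (⟨X⟩ ⟨*⟩ (⟨X⟩ ⟨+⟩ ⟨1⟩) ⟨*⟩ (⟨X⟩ ⟨*⟩ (⟨X⟩ ⟨-⟩ ⟨1⟩) ⟨*⟩ ⟨ g ⟩ ⟨+⟩ ⟨1⟩) ⟨-⟩ ⟨X⟩))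
        (solve 2 (λ y g →
          y :* (y :+ con (+ 1)) :* (y :* (y :- con (+ 1)) :* g :+ con (+ 1)) :- y :=
          y :* y :* ((y :* y :- con (+ 1)) :* g :+ con (+ 1))) refl (y n) (γ n))) μ-suc n)
    convergent (inj₂ (inj₂ (inj₂ (inj₂ (inj₂ (inj₂ eq)))))) n = fromMinus (Minus.TwoTerm.expansion γ Int-γ
      (λ n → trans (+-congʳ (step-form n eq
          (⟨X⟩ ⟨*⟩ (⟨X⟩ ⟨+⟩ ⟨1⟩) ⟨*⟩ ((⟨X⟩ ⟨+⟩ ⟨2⟩) ⟨*⟩ (⟨X⟩ ⟨+⟩ ⟨1⟩) ⟨*⟩ ⟨ g ⟩ ⟨-⟩ ⟨1⟩) ⟨-⟩ ⟨X⟩ ⟨-⟩ ⟨2⟩)))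
        (solve 2 (λ y g → let e = y :+ con (+ 1) ; 1:2 = con (+ 1) :+ con (+ 1) in
          y :* (y :+ con (+ 1)) :* ((y :+ 1:2) :* (y :+ con (+ 1)) :* g :- con (+ 1)) :- y :- 1:2 :+ con (+ 1) :=
          e :* e :* ((e :* e :- con (+ 1)) :* g :+ :- con (+ 1))) refl (y n) (γ n))) μ-suc n)

-- Power series and polynomials over a field

record DiscreteField : Set₁ where
  infix  8 -_
  infixl 7 _*_
  infixl 6 _+_
  field
    Scalar            : Set
    _+_ _*_           : Scalar → Scalar → Scalar
    -_                : Scalar → Scalar
    0# 1#             : Scalar
    isCommutativeRing : IsCommutativeRing _≡_ _+_ _*_ -_ 0# 1#
    _≟_               : (x y : Scalar) → Dec (x ≡ y)
    invertible        : ∀ x → ¬ x ≡ 0# → ∃ λ y → y * x ≡ 1#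

  commutativeRing : CommutativeRing 0ℓ 0ℓ
  commutativeRing = record { isCommutativeRing = isCommutativeRing }

  open CommutativeRing commutativeRing public
    using (_-_; +-assoc; +-comm; +-identityˡ; +-identityʳ; -‿inverseʳ; *-assoc; *-comm; *-identityˡ; *-identityʳ; zeroˡ; zeroʳ; distribʳ)

module Series (𝓕 : DiscreteField) where
  open DiscreteField 𝓕
  open ≡ using (refl; sym; trans; cong; cong₂)
  open IntegerSolver commutativeRing
  open ≡.≡-Reasoning

  *-nonzero : ∀ {p q} → ¬ p ≡ 0# → ¬ q ≡ 0# → ¬ p * q ≡ 0#
  *-nonzero {p} {q} p≢0 q≢0 pq≡0 with invertible p p≢0
  ... | p⁻¹ , p⁻¹p≡1 = q≢0 (begin
    q              ≡⟨ *-identityˡ q ⟨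
    1# * q         ≡⟨ cong (_* q) p⁻¹p≡1 ⟨
    p⁻¹ * p * q    ≡⟨ *-assoc p⁻¹ p q ⟩
    p⁻¹ * (p * q)  ≡⟨ cong (p⁻¹ *_) pq≡0 ⟩
    p⁻¹ * 0#       ≡⟨ zeroʳ p⁻¹ ⟩
    0#             ∎)

  *-+-0 : ∀ {p q r} → q ≡ 0# → r ≡ 0# → p * q + r ≡ 0#
  *-+-0 {p} refl refl = solve 1 (λ p → p :* con (+ 0) :+ con (+ 0) := con (+ 0)) refl p

  0*+ : ∀ {p q r} → p ≡ 0# → p * q + r ≡ r
  0*+ {q = q} {r} refl = solve 2 (λ q r → con (+ 0) :* q :+ r := r) refl q r

  *0+ : ∀ {p q r} → q ≡ 0# → p * q + r ≡ r
  *0+ {p} {r = r} refl = solve 2 (λ q r → q :* con (+ 0) :+ r := r) refl p r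

  tail : (ℕ → Scalar) → ℕ → Scalar
  tail a n = a (suc n)

  infixl 7 _⋆_
  -- The Cauchy product, by recursion on `a = a₀ + x a'`. In this form the ring laws follow by
  -- induction, without manipulating finite sums.
  _⋆_ : (a b : ℕ → Scalar) → ℕ → Scalar
  (a ⋆ b) zero    = a 0 * b 0
  (a ⋆ b) (suc n) = a 0 * b (suc n) + (tail a ⋆ b) n

  private
    variable
      a a' b b' : ℕ → Scalar

  -- The bounded form serves for series that are known to finite precision only.
  ⋆-cong-≤ : ∀ n → (∀ i → i ℕ.≤ n → a i ≡ a' i) → (∀ i → i ℕ.≤ n → b i ≡ b' i) → (a ⋆ b) n ≡ (a' ⋆ b') n
  ⋆-cong-≤ zero    eq eq' = cong₂ _*_ (eq 0 ℕ.z≤n) (eq' 0 ℕ.z≤n)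
  ⋆-cong-≤ (suc n) eq eq' = cong₂ _+_ (cong₂ _*_ (eq 0 ℕ.z≤n) (eq' (suc n) ℕP.≤-refl))
    (⋆-cong-≤ n (λ i i≤n → eq (suc i) (ℕ.s≤s i≤n)) (λ i i≤n → eq' i (ℕP.m≤n⇒m≤1+n i≤n)))

  ⋆-cong : (∀ i → a i ≡ a' i) → (∀ i → b i ≡ b' i) → ∀ n → (a ⋆ b) n ≡ (a' ⋆ b') n
  ⋆-cong eq eq' n = ⋆-cong-≤ n (λ i _ → eq i) (λ i _ → eq' i)

  0⋆ : ∀ n → (∀ i → a i ≡ 0#) → (a ⋆ b) n ≡ 0#
  0⋆ {b = b} zero    eq = trans (cong (_* b 0) (eq 0)) (zeroˡ (b 0))
  0⋆         (suc n) eq = trans (0*+ (eq 0)) (0⋆ n (λ i → eq (suc i)))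

  ⋆-head : ∀ (a b : ℕ → Scalar) → a 0 ≡ 0# → (a ⋆ b) 0 ≡ 0#
  ⋆-head a b a₀≡0 = trans (cong (_* b 0) a₀≡0) (zeroˡ (b 0))

  ⋆-tail : ∀ (a b : ℕ → Scalar) n → a 0 ≡ 0# → (a ⋆ b) (suc n) ≡ (tail a ⋆ b) n
  ⋆-tail a b n = 0*+

  ⋆-constant : ∀ (a b : ℕ → Scalar) n → (∀ i → a (suc i) ≡ 0#) → (a ⋆ b) n ≡ a 0 * b n
  ⋆-constant a b zero    eq = refl
  ⋆-constant a b (suc n) eq = trans (cong (_+_ _) (0⋆ n eq)) (+-identityʳ _)

  ⋆-distribʳ : ∀ (a b c : ℕ → Scalar) n → ((λ i → a i + b i) ⋆ c) n ≡ (a ⋆ c) n + (b ⋆ c) n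
  ⋆-distribʳ a b c zero    = distribʳ (c 0) (a 0) (b 0)
  ⋆-distribʳ a b c (suc n) = trans (cong (_+_ _) (⋆-distribʳ (tail a) (tail b) c n))
    (solve 5 (λ a b c x y → (a :+ b) :* c :+ (x :+ y) := a :* c :+ x :+ (b :* c :+ y)) refl
       (a 0) (b 0) (c (suc n)) ((tail a ⋆ c) n) ((tail b ⋆ c) n))

  ⋆-scale : ∀ k (a b : ℕ → Scalar) n → ((λ i → k * a i) ⋆ b) n ≡ k * (a ⋆ b) n
  ⋆-scale k a b zero    = *-assoc k (a 0) (b 0)
  ⋆-scale k a b (suc n) = trans (cong (_+_ _) (⋆-scale k (tail a) b n))
    (solve 4 (λ k a b x → k :* a :* b :+ k :* x := k :* (a :* b :+ x)) refl k (a 0) (b (suc n)) ((tail a ⋆ b) n))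

  ⋆-assoc : ∀ (a b c : ℕ → Scalar) n → (a ⋆ b ⋆ c) n ≡ (a ⋆ (b ⋆ c)) n
  ⋆-assoc a b c zero    = *-assoc (a 0) (b 0) (c 0)
  ⋆-assoc a b c (suc n) = begin
    a 0 * b 0 * c (suc n) + ((λ i → a 0 * tail b i + (tail a ⋆ b) i) ⋆ c) n
      ≡⟨ cong (_+_ _) (⋆-distribʳ (λ i → a 0 * tail b i) (tail a ⋆ b) c n) ⟩
    a 0 * b 0 * c (suc n) + (((λ i → a 0 * tail b i) ⋆ c) n + (tail a ⋆ b ⋆ c) n)
      ≡⟨ cong (_+_ _) (cong₂ _+_ (⋆-scale (a 0) (tail b) c n) (⋆-assoc (tail a) b c n)) ⟩
    a 0 * b 0 * c (suc n) + (a 0 * (tail b ⋆ c) n + (tail a ⋆ (b ⋆ c)) n)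
      ≡⟨ solve 5 (λ a b c x y → a :* b :* c :+ (a :* x :+ y) := a :* (b :* c :+ x) :+ y) refl
           (a 0) (b 0) (c (suc n)) ((tail b ⋆ c) n) ((tail a ⋆ (b ⋆ c)) n) ⟩
    (a ⋆ (b ⋆ c)) (suc n) ∎

  ⋆-suc : ∀ (a b : ℕ → Scalar) n → (a ⋆ b) (suc n) ≡ a (suc n) * b 0 + (a ⋆ tail b) n
  ⋆-suc a b zero    = +-comm (a 0 * b 1) (a 1 * b 0)
  ⋆-suc a b (suc n) = trans (cong (_+_ _) (⋆-suc (tail a) b n))
    (solve 3 (λ x y z → x :+ (y :+ z) := y :+ (x :+ z)) refl
       (a 0 * b (suc (suc n))) (a (suc (suc n)) * b 0) ((tail a ⋆ tail b) n))

  ⋆-comm : ∀ (a b : ℕ → Scalar) n → (a ⋆ b) n ≡ (b ⋆ a) n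
  ⋆-comm a b zero    = *-comm (a 0) (b 0)
  ⋆-comm a b (suc n) = trans (cong₂ _+_ (*-comm (a 0) (b (suc n))) (⋆-comm (tail a) b n)) (sym (⋆-suc b a n))

  ⋆-below : ∀ k {M N} → (∀ i → M ℕ.≤ i → a i ≡ 0#) → (∀ i → N ℕ.≤ i → b i ≡ 0#) →
            M ℕ.+ N ℕ.≤ suc k → (a ⋆ b) k ≡ 0#
  ⋆-below k {zero} a≡0 b≡0 le = 0⋆ k (λ i → a≡0 i ℕ.z≤n)
  ⋆-below {a} zero {suc M} a≡0 b≡0 (ℕ.s≤s le) =
    trans (cong (a 0 *_) (b≡0 0 (ℕP.≤-trans (ℕP.m≤n+m _ M) le))) (zeroʳ (a 0))
  ⋆-below (suc k) {suc M} a≡0 b≡0 (ℕ.s≤s le) =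
    *-+-0 (b≡0 (suc k) (ℕP.≤-trans (ℕP.m≤n+m _ M) le)) (⋆-below k (λ i M≤i → a≡0 (suc i) (ℕ.s≤s M≤i)) b≡0 le)

  ⋆-top : ∀ m n → (∀ i → m ℕ.< i → a i ≡ 0#) → (∀ i → n ℕ.< i → b i ≡ 0#) → (a ⋆ b) (m ℕ.+ n) ≡ a m * b n
  ⋆-top         zero    zero    a≡0 b≡0 = refl
  ⋆-top {a} {b} zero    (suc n) a≡0 b≡0 =
    trans (cong (_+_ _) (0⋆ n (λ i → a≡0 (suc i) (ℕ.s≤s ℕ.z≤n)))) (+-identityʳ _)
  ⋆-top         (suc m) n       a≡0 b≡0 =
    trans (*0+ (b≡0 (suc (m ℕ.+ n)) (ℕ.s≤s (ℕP.m≤n+m n m)))) (⋆-top m n (λ i m<i → a≡0 (suc i) (ℕ.s≤s m<i)) b≡0)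

  -- Long division: the leading coefficient of e is cleared by a multiple of s.
  module Division (s : ℕ → Scalar) (s₀≢0 : ¬ s 0 ≡ 0#) where
    s₀⁻¹ : Scalar
    s₀⁻¹ = proj₁ (invertible (s 0) s₀≢0)

    leading : (ℕ → Scalar) → Scalar
    leading e = e 0 * s₀⁻¹

    divide : (ℕ → Scalar) → ℕ → Scalar
    divide e zero    = leading e
    divide e (suc n) = divide (λ i → e (suc i) - leading e * s (suc i)) n

    divide-⋆ : ∀ e n → (divide e ⋆ s) n ≡ e n
    divide-⋆ e zero    = trans (*-assoc (e 0) (s₀⁻¹) (s 0))
      (trans (cong (e 0 *_) (proj₂ (invertible (s 0) s₀≢0))) (*-identityʳ (e 0)))
    divide-⋆ e (suc n) = trans (cong (_+_ _) (divide-⋆ _ n))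
      (solve 2 (λ x y → x :+ (y :- x) := y) refl (leading e * s (suc n)) (e (suc n)))

  ⋆-cancelʳ-< : ∀ n → ¬ b 0 ≡ 0# → (∀ i → i ℕ.< n → (a ⋆ b) i ≡ 0#) → ∀ i → i ℕ.< n → a i ≡ 0#
  ⋆-cancelʳ-< {b} {a} (suc n) b₀≢0 eq = cancel
    where
    a₀≡0 : a 0 ≡ 0#
    a₀≡0 with a 0 ≟ 0#
    ... | yes a₀≡0 = a₀≡0
    ... | no  a₀≢0 = ⊥-elim (*-nonzero a₀≢0 b₀≢0 (eq 0 (ℕ.s≤s ℕ.z≤n)))
    cancel : ∀ i → i ℕ.< suc n → a i ≡ 0#
    cancel zero    _           = a₀≡0
    cancel (suc i) (ℕ.s≤s i<n) =
      ⋆-cancelʳ-< n b₀≢0 (λ j j<n → trans (sym (0*+ a₀≡0)) (eq (suc j) (ℕ.s≤s j<n))) i i<n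

module Polynomials (𝓕 : DiscreteField) where
  open DiscreteField 𝓕
  open ≡ using (refl; sym; trans; cong; cong₂)
  open Series 𝓕
  open TopCoefficient 0# _+_ _*_ _≟_ using (zero-or-Top; NonZero⇒Top)
  open PolyOps 0# _+_ _*_ using (Poly; coeff; _+ₚ_; _*ₚ_; scale; _≈_; IsZeroP; NonZeroP)
  open IntegerSolver commutativeRing

  coeff-+ : ∀ p q k → coeff (p +ₚ q) k ≡ coeff p k + coeff q k
  coeff-+ []      q       k       = sym (+-identityˡ _)
  coeff-+ (a ∷ p) []      k       = sym (+-identityʳ _)
  coeff-+ (a ∷ p) (b ∷ q) zero    = refl
  coeff-+ (a ∷ p) (b ∷ q) (suc k) = coeff-+ p q k

  coeff-scale : ∀ a p k → coeff (scale a p) k ≡ a * coeff p k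
  coeff-scale a []      k       = sym (zeroʳ a)
  coeff-scale a (b ∷ p) zero    = refl
  coeff-scale a (b ∷ p) (suc k) = coeff-scale a p k

  coeff-* : ∀ p q k → coeff (p *ₚ q) k ≡ (coeff p ⋆ coeff q) k
  coeff-* []      q k       = sym (0⋆ k (λ _ → refl))
  coeff-* (a ∷ p) q zero    = trans (coeff-+ (scale a q) _ 0) (trans (+-identityʳ _) (coeff-scale a q 0))
  coeff-* (a ∷ p) q (suc k) = trans (coeff-+ (scale a q) _ (suc k)) (cong₂ _+_ (coeff-scale a q (suc k)) (coeff-* p q k))

  -- Unlike _≈_, which unfolds to a function type, this relation lets Agda infer p and q.
  infix 4 _≋_
  record _≋_ (p q : Poly) : Set where
    constructor mk≋
    field at : p ≈ q
  open _≋_ public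

  one : Poly
  one = 1# ∷ []

  neg : Poly → Poly
  neg = scale (- 1#)

  coeff-neg : ∀ p k → coeff (neg p) k ≡ - coeff p k
  coeff-neg p k = trans (coeff-scale (- 1#) p k) (solve 1 (λ x → (:- con (+ 1)) :* x := :- x) refl (coeff p k))

  ≋-refl : ∀ {p} → p ≋ p
  ≋-refl = mk≋ (λ _ → refl)

  ≋-sym : ∀ {p q} → p ≋ q → q ≋ p
  ≋-sym (mk≋ eq) = mk≋ (λ k → sym (eq k))

  ≋-trans : ∀ {p q r} → p ≋ q → q ≋ r → p ≋ r
  ≋-trans (mk≋ eq) (mk≋ eq') = mk≋ (λ k → trans (eq k) (eq' k))

  +ₚ-cong : ∀ {p p' q q'} → p ≋ p' → q ≋ q' → p +ₚ q ≋ p' +ₚ q'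
  +ₚ-cong {p} {p'} {q} {q'} (mk≋ eq) (mk≋ eq') =
    mk≋ (λ k → trans (coeff-+ p q k) (trans (cong₂ _+_ (eq k) (eq' k)) (sym (coeff-+ p' q' k))))

  +ₚ-assoc : ∀ p q r → p +ₚ q +ₚ r ≋ p +ₚ (q +ₚ r)
  +ₚ-assoc p q r = mk≋ λ k → trans (trans (coeff-+ (p +ₚ q) r k) (cong (_+ coeff r k) (coeff-+ p q k)))
    (trans (+-assoc (coeff p k) (coeff q k) (coeff r k))
      (sym (trans (coeff-+ p (q +ₚ r) k) (cong (_+_ (coeff p k)) (coeff-+ q r k)))))

  +ₚ-comm : ∀ p q → p +ₚ q ≋ q +ₚ p
  +ₚ-comm p q = mk≋ λ k → trans (coeff-+ p q k) (trans (+-comm (coeff p k) (coeff q k)) (sym (coeff-+ q p k)))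

  +ₚ-identityʳ : ∀ p → p +ₚ [] ≋ p
  +ₚ-identityʳ p = mk≋ λ k → trans (coeff-+ p [] k) (+-identityʳ _)

  +ₚ-inverseʳ : ∀ p → p +ₚ neg p ≋ []
  +ₚ-inverseʳ p = mk≋ λ k → trans (coeff-+ p (neg p) k)
    (trans (cong (_+_ (coeff p k)) (coeff-neg p k)) (-‿inverseʳ (coeff p k)))

  neg-cong : ∀ {p q} → p ≋ q → neg p ≋ neg q
  neg-cong {p} {q} (mk≋ eq) = mk≋ λ k → trans (coeff-neg p k) (trans (cong -_ (eq k)) (sym (coeff-neg q k)))

  *ₚ-cong : ∀ {p p' q q'} → p ≋ p' → q ≋ q' → p *ₚ q ≋ p' *ₚ q'
  *ₚ-cong {p} {p'} {q} {q'} (mk≋ eq) (mk≋ eq') =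
    mk≋ (λ k → trans (coeff-* p q k) (trans (⋆-cong eq eq' k) (sym (coeff-* p' q' k))))

  *ₚ-assoc : ∀ p q r → p *ₚ q *ₚ r ≋ p *ₚ (q *ₚ r)
  *ₚ-assoc p q r = mk≋ λ k → trans (trans (coeff-* (p *ₚ q) r k) (⋆-cong (coeff-* p q) (λ _ → refl) k))
    (trans (⋆-assoc (coeff p) (coeff q) (coeff r) k)
      (sym (trans (coeff-* p (q *ₚ r) k) (⋆-cong {a = coeff p} (λ _ → refl) (coeff-* q r) k))))

  *ₚ-comm : ∀ p q → p *ₚ q ≋ q *ₚ p
  *ₚ-comm p q = mk≋ λ k → trans (coeff-* p q k) (trans (⋆-comm (coeff p) (coeff q) k) (sym (coeff-* q p k)))

  *ₚ-identityˡ : ∀ p → one *ₚ p ≋ p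
  *ₚ-identityˡ p = mk≋ λ where
    zero    → trans (coeff-* one p 0) (*-identityˡ _)
    (suc k) → trans (coeff-* one p (suc k)) (trans (cong₂ _+_ (*-identityˡ _) (0⋆ k (λ _ → refl))) (+-identityʳ _))

  *ₚ-distribʳ : ∀ r p q → (p +ₚ q) *ₚ r ≋ p *ₚ r +ₚ q *ₚ r
  *ₚ-distribʳ r p q = mk≋ λ k → trans (trans (coeff-* (p +ₚ q) r k) (⋆-cong (coeff-+ p q) (λ _ → refl) k))
    (trans (⋆-distribʳ (coeff p) (coeff q) (coeff r) k)
      (sym (trans (coeff-+ (p *ₚ r) (q *ₚ r) k) (cong₂ _+_ (coeff-* p r k) (coeff-* q r k)))))

  polynomialRing : CommutativeRing 0ℓ 0ℓ
  polynomialRing = record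
    { Carrier = Poly ; _≈_ = _≋_ ; _+_ = _+ₚ_ ; _*_ = _*ₚ_ ; -_ = neg ; 0# = [] ; 1# = one
    ; isCommutativeRing = record
      { isRing = record
        { +-isAbelianGroup = record
          { isGroup = record
            { isMonoid = record
              { isSemigroup = record
                { isMagma = record
                  { isEquivalence = record { refl = ≋-refl ; sym = ≋-sym ; trans = ≋-trans }
                  ; ∙-cong = +ₚ-cong }
                ; assoc = +ₚ-assoc }
              ; identity = (λ p → ≋-refl) , +ₚ-identityʳ }
            ; inverse = (λ p → ≋-trans (+ₚ-comm (neg p) p) (+ₚ-inverseʳ p)) , +ₚ-inverseʳ
            ; ⁻¹-cong = neg-cong }
          ; comm = +ₚ-comm }
        ; *-cong = *ₚ-cong
        ; *-assoc = *ₚ-assoc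
        ; *-identity = *ₚ-identityˡ , (λ p → ≋-trans (*ₚ-comm p one) (*ₚ-identityˡ p))
        ; distrib = (λ r p q → ≋-trans (*ₚ-comm r (p +ₚ q)) (≋-trans (*ₚ-distribʳ r p q)
                      (+ₚ-cong (*ₚ-comm p r) (*ₚ-comm q r)))) , *ₚ-distribʳ }
      ; *-comm = *ₚ-comm } }

  -- A record for the same reason as _≋_.
  record Deg (p : Poly) (n : ℕ) : Set where
    constructor mkDeg
    field
      leading≢0 : ¬ coeff p n ≡ 0#
      above≡0   : ∀ k → n ℕ.< k → coeff p k ≡ 0#
  open Deg public

  record Below (p : Poly) (n : ℕ) : Set where
    constructor mkBelow
    field from≡0 : ∀ k → n ℕ.≤ k → coeff p k ≡ 0#
  open Below public

  Deg-resp : ∀ {p q n} → p ≋ q → Deg p n → Deg q n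
  Deg-resp (mk≋ eq) (mkDeg ne z) = mkDeg (λ q≡0 → ne (trans (eq _) q≡0)) (λ k n<k → trans (sym (eq k)) (z k n<k))

  Deg-* : ∀ {p q m n} → Deg p m → Deg q n → Deg (p *ₚ q) (m ℕ.+ n)
  Deg-* {p} {q} {m} {n} (mkDeg ne z) (mkDeg ne' z') = mkDeg
    (λ eq → *-nonzero ne ne' (trans (sym (⋆-top m n z z')) (trans (sym (coeff-* p q (m ℕ.+ n))) eq)))
    (λ k lt → trans (coeff-* p q k) (⋆-below k z z' (ℕ.s≤s (ℕP.≤-trans (ℕP.≤-reflexive (ℕP.+-suc m n)) lt))))

  Deg-+ : ∀ {p q n} → Deg p n → Below q n → Deg (p +ₚ q) n
  Deg-+ {p} {q} {n} (mkDeg ne z) (mkBelow z') = mkDeg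
    (λ eq → ne (trans (sym (+-identityʳ _)) (trans (cong (_+_ (coeff p n)) (sym (z' n ℕP.≤-refl)))
      (trans (sym (coeff-+ p q n)) eq))))
    (λ k n<k → trans (coeff-+ p q k) (trans (cong₂ _+_ (z k n<k) (z' k (ℕP.<⇒≤ n<k))) (+-identityʳ _)))

  Deg-unique : ∀ {p m n} → Deg p m → Deg p n → m ≡ n
  Deg-unique {m = m} {n} (mkDeg ne z) (mkDeg ne' z') = ℕP.≤-antisym
    (ℕP.≮⇒≥ (λ n<m → ne (z' m n<m))) (ℕP.≮⇒≥ (λ m<n → ne' (z n m<n)))

  zero-or-Deg : ∀ p → IsZeroP p ⊎ ∃ (Deg p)
  zero-or-Deg p with zero-or-Top p
  ... | inj₁ z            = inj₁ z
  ... | inj₂ (n , ne , z) = inj₂ (n , mkDeg ne z)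

  nonzero⇒Deg : ∀ p → NonZeroP p → ∃ (Deg p)
  nonzero⇒Deg p p≢0 with NonZero⇒Top p p≢0
  ... | n , ne , z = n , mkDeg ne z

  Deg-factor : ∀ {p q n} → Deg (p *ₚ q) n → ∃ (Deg p)
  Deg-factor {p} {q} {n} (mkDeg ne _) with zero-or-Deg p
  ... | inj₁ z   = ⊥-elim (ne (trans (coeff-* p q n) (0⋆ n z)))
  ... | inj₂ deg = deg

  Below-* : ∀ {p q m n} → Deg p m → Below q n → Below (p *ₚ q) (m ℕ.+ n)
  Below-* {p} {q} (mkDeg _ z) (mkBelow z') =
    mkBelow λ k le → trans (coeff-* p q k) (⋆-below k z z' (ℕ.s≤s le))

  Below-+ : ∀ {p q n} → Below p n → Below q n → Below (p +ₚ q) n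
  Below-+ {p} {q} (mkBelow z) (mkBelow z') =
    mkBelow λ k le → trans (coeff-+ p q k) (trans (cong₂ _+_ (z k le) (z' k le)) (+-identityʳ _))

-- Rational polynomials and the Euclidean algorithm

module DivisionUniqueness (𝓓 : DegreeRing)
  (cancel : ∀ {e D d} → DegreeRing.Deg 𝓓 D d → DegreeRing.Below 𝓓 (DegreeRing._*_ 𝓓 e D) d →
            DegreeRing._≈_ 𝓓 e (DegreeRing.0# 𝓓)) where
  open DegreeRing 𝓓
  open IntegerSolver commutativeRing
  open ContinuedFractions 𝓓

  -- The difference `s - r` of the remainders is `(q - a) D`; it lies below the degree of `D`, so
  -- `cancel` applies.
  division-unique : ∀ {N D q r a s d} → N ≈ q * D + r → N ≈ a * D + s →
                    Deg D d → Below r d → Below s d → q ≈ a × r ≈ s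
  division-unique {N} {D} {q} {r} {a} {s} eq eq' degD belowr belows = q≈a , r≈s
    where
    e*D≈ : s - r ≈ (q - a) * D
    e*D≈ = x≈y+k[a-b]⇒x≈y _ eq (x≈y+k[a-b]⇒x≈y _ (sym eq') (solve 6 (λ N D q r a s →
      s :- r := (q :- a) :* D :+ con (+ 1) :* (N :- (q :* D :+ r)) :+ con (+ 1) :* (a :* D :+ s :- N)) refl N D q r a s))
    q-a≈0 : q - a ≈ 0#
    q-a≈0 = cancel degD (Below-resp e*D≈ (Below-+ belows (Below-neg belowr)))
    q≈a : q ≈ a
    q≈a = x≈y+k[a-b]⇒x≈y _ q-a≈0 (solve 2 (λ q a → q := a :+ con (+ 1) :* (q :- a :- con (+ 0))) refl q a)
    r≈s : r ≈ s
    r≈s = x≈y+k[a-b]⇒x≈y _ e*D≈ (x≈y+k[a-b]⇒x≈y _ q-a≈0 (solve 4 (λ D e r s →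
      r := s :+ (:- con (+ 1)) :* (s :- r :- e :* D) :+ (:- D) :* (e :- con (+ 0))) refl D (q - a) r s))

  -- The remainder of N by D is u * R because R has lower degree than P.
  quotient-unique : ∀ {N D q r u a P U R V d} → CF P U R V → N ≈ u * (a * P + R) → D ≈ u * P →
                    N ≈ q * D + r → Deg D d → Below r d → q ≈ a × r ≈ u * R
  quotient-unique {N} {D} {u = u} {a} {P} {R = R} cf N≈ D≈ eq degD belowr =
    division-unique eq
      (trans N≈ (x≈y+k[a-b]⇒x≈y _ (sym D≈) (solve 5 (λ D u a P R →
        u :* (a :* P :+ R) := a :* D :+ u :* R :+ a :* (u :* P :- D)) refl D u a P R)))
      degD belowr belowuR
    where
    open Degrees (CF-Degrees cf)
    degu : ∃ (Deg u)
    degu = Deg-factor (Deg-resp D≈ degD)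
    belowuR : Below (u * R) _
    belowuR = ≡.subst (Below (u * R)) (Deg-unique (Deg-resp (sym D≈) (Deg-* (proj₂ degu) Deg-D)) degD)
      (Below-* (proj₂ degu) Below-R)

ℚ-field : DiscreteField
ℚ-field = record
  { isCommutativeRing = ℚP.+-*-isCommutativeRing
  ; _≟_ = ℚP._≟_
  ; invertible = λ x x≢0 → ℚ.1/_ x {{ℚ.≢-nonZero x≢0}} , ℚP.*-inverseˡ x {{ℚ.≢-nonZero x≢0}} }

open Polynomials ℚ-field

-- `_/_` reduces fractions, which blocks computation with a variable numerator. Among unnormalised
-- rationals the denominator is simply 1, and the homomorphism laws become integer identities.
toℚᵘ-toℚ : ∀ i → ℚ.toℚᵘ (toℚ i) ℚᵘ.≃ mkℚᵘ i 0
toℚᵘ-toℚ i = ℚP.toℚᵘ-fromℚᵘ (mkℚᵘ i 0)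

toℚ-+ : ∀ i j → toℚ (i ℤ.+ j) ≡ toℚ i ℚ.+ toℚ j
toℚ-+ i j = ℚP.toℚᵘ-injective (ℚᵘP.≃-trans (toℚᵘ-toℚ (i ℤ.+ j)) (ℚᵘP.≃-sym (ℚᵘP.≃-trans
  (ℚP.toℚᵘ-homo-+ (toℚ i) (toℚ j)) (ℚᵘP.≃-trans (ℚᵘP.+-cong (toℚᵘ-toℚ i) (toℚᵘ-toℚ j))
  (*≡* (ℤS.solve 2 (λ i j → (i ℤS.:* ℤS.con (+ 1) ℤS.:+ j ℤS.:* ℤS.con (+ 1)) ℤS.:* ℤS.con (+ 1) ℤS.:=
    (i ℤS.:+ j) ℤS.:* ℤS.con (+ 1)) ≡.refl i j))))))

toℚ-* : ∀ i j → toℚ (i ℤ.* j) ≡ toℚ i ℚ.* toℚ j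
toℚ-* i j = ℚP.toℚᵘ-injective (ℚᵘP.≃-trans (toℚᵘ-toℚ (i ℤ.* j)) (ℚᵘP.≃-sym (ℚᵘP.≃-trans
  (ℚP.toℚᵘ-homo-* (toℚ i) (toℚ j)) (ℚᵘP.≃-trans (ℚᵘP.*-cong (toℚᵘ-toℚ i) (toℚᵘ-toℚ j)) (*≡* ≡.refl)))))

toℚ≡0 : ∀ {i} → toℚ i ≡ 0ℚ → i ≡ + 0
toℚ≡0 {i} eq with ℚP.fromℚᵘ-injective {mkℚᵘ i 0} {mkℚᵘ (+ 0) 0} eq
... | *≡* i*1≡0*1 = ≡.trans (≡.sym (ℤP.*-identityʳ i)) i*1≡0*1

emb-+ : ∀ p q → emb (p Z.+ₚ q) ≡ emb p Q.+ₚ emb q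
emb-+ []      q       = ≡.refl
emb-+ (a ∷ p) []      = ≡.refl
emb-+ (a ∷ p) (b ∷ q) = ≡.cong₂ _∷_ (toℚ-+ a b) (emb-+ p q)

emb-scale : ∀ a p → emb (Z.scale a p) ≡ Q.scale (toℚ a) (emb p)
emb-scale a []      = ≡.refl
emb-scale a (b ∷ p) = ≡.cong₂ _∷_ (toℚ-* a b) (emb-scale a p)

emb-* : ∀ p q → emb (p Z.*ₚ q) ≡ emb p Q.*ₚ emb q
emb-* []      q = ≡.refl
emb-* (a ∷ p) q = ≡.trans (emb-+ (Z.scale a q) (+ 0 ∷ p Z.*ₚ q))
  (≡.cong₂ Q._+ₚ_ (emb-scale a q) (≡.cong (0ℚ ∷_) (emb-* p q)))

≡⇒≋ : ∀ {p q} → p ≡ q → p ≋ q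
≡⇒≋ ≡.refl = ≋-refl

𝓓 : DegreeRing
𝓓 = record
  { commutativeRing = polynomialRing
  ; Int        = IsIntPoly
  ; Int-resp   = λ { (mk≋ p≈q) (z , eq) → z , λ k → ≡.trans (eq k) (p≈q k) }
  ; Int-0      = [] , λ _ → ≡.refl
  ; Int-1      = cz (+ 1) , λ _ → ≡.refl
  ; Int-+      = λ { {p} {q} (z , eq) (w , eq') → z Z.+ₚ w ,
                   at (≋-trans (≡⇒≋ (emb-+ z w)) (+ₚ-cong {emb z} {p} {emb w} {q} (mk≋ eq) (mk≋ eq'))) }
  ; Int-*      = λ { {p} {q} (z , eq) (w , eq') → z Z.*ₚ w ,
                   at (≋-trans (≡⇒≋ (emb-* z w)) (*ₚ-cong {emb z} {p} {emb w} {q} (mk≋ eq) (mk≋ eq'))) }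
  ; Int-neg    = λ { {p} (z , eq) → Z.scale (ℤ.- (+ 1)) z ,
                   at (≋-trans (≡⇒≋ (emb-scale (ℤ.- (+ 1)) z)) (neg-cong {emb z} {p} (mk≋ eq))) }
  ; Deg        = Deg
  ; Below      = Below
  ; Deg-resp   = Deg-resp
  ; Deg-1      = mkDeg ℚP.1≢0 (λ { (suc k) _ → ≡.refl })
  ; Deg-*      = Deg-*
  ; Deg-+      = Deg-+
  ; Deg-unique = Deg-unique
  ; Deg-factor = λ {p} {q} → Deg-factor {p} {q}
  ; Below-resp = λ { (mk≋ eq) (mkBelow z) → mkBelow λ k le → ≡.trans (≡.sym (eq k)) (z k le) }
  ; Below-0    = mkBelow λ _ _ → ≡.refl
  ; Below-≤    = λ { m≤n (mkBelow z) → mkBelow λ k n≤k → z k (ℕP.≤-trans m≤n n≤k) }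
  ; Below-+    = Below-+
  ; Below-*    = Below-*
  ; Deg⇒Below  = λ { (mkDeg _ z) m<n → mkBelow λ k n≤k → z k (ℕP.<-≤-trans m<n n≤k) } }

𝓢 : Scalars 𝓓
𝓢 = record
  { ι     = λ i → toℚ i ∷ []
  ; ι-+   = λ i j → ≡⇒≋ (≡.cong (_∷ []) (toℚ-+ i j))
  ; ι-*   = λ i j → mk≋ λ { zero → ≡.trans (toℚ-* i j) (≡.sym (ℚP.+-identityʳ _)) ; (suc k) → ≡.refl }
  ; ι-0   = mk≋ λ { zero → ≡.refl ; (suc k) → ≡.refl }
  ; ι-1   = ≋-refl
  ; Int-ι = λ i → cz i , λ _ → ≡.refl
  ; Deg-ι = λ i≢0 → mkDeg (λ eq → i≢0 (toℚ≡0 eq)) (λ { (suc k) _ → ≡.refl }) }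

open ContinuedFractions 𝓓
open Products 𝓓 using (prod)
open Convergents 𝓓 𝓢
open Evaluation 𝓓 𝓢 using (ev)
module 𝓓 = DegreeRing 𝓓

∘ₚ≡ev : ∀ p q → emb p Q.∘ₚ q ≡ ev q p
∘ₚ≡ev []      q = ≡.refl
∘ₚ≡ev (a ∷ p) q = ≡.cong (λ r → (toℚ a ∷ []) Q.+ₚ (q Q.*ₚ r)) (∘ₚ≡ev p q)

iter₊ : ZPoly → ℕ → QPoly
iter₊ f n = iter f n Q.+ₚ one

numer≡ : ∀ f n → numer f n ≡ prod (iter₊ f) n
numer≡ f zero    = ≡.refl
numer≡ f (suc n) = ≡.cong (Q._*ₚ iter₊ f (suc n)) (numer≡ f n)

denom≡ : ∀ f n → denom f n ≡ prod (iter f) n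
denom≡ f zero    = ≡.refl
denom≡ f (suc n) = ≡.cong (Q._*ₚ iter f (suc n)) (denom≡ f n)

convergents : ∀ f G g → Z.NonZeroP G → Z.NonZeroP g → DegAtLeast3 f → Form f G g →
              ∀ n → Convergent (numer f n) (denom f n)
convergents f G g G≢0 g≢0 f≥3 form n =
  ≡.subst₂ Convergent (≡.sym (numer≡ f n)) (≡.sym (denom≡ f n))
    (Orbit.convergent f G g f≥3 G≢0 g≢0 (iter f) (λ n → ≡⇒≋ (∘ₚ≡ev f (iter f n)))
      (Xz , λ _ → ≡.refl) (mkDeg ℚP.1≢0 (λ { (suc (suc k)) _ → ≡.refl ; (suc zero) (ℕ.s≤s ()) })) form n)

Below-*⇒0 : ∀ {e D d} → Deg D d → Below (e Q.*ₚ D) d → e ≋ []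
Below-*⇒0 {e} {D} {d} degD (mkBelow z) with zero-or-Deg e
... | inj₁ e≡0        = mk≋ e≡0
... | inj₂ (m , dege) = ⊥-elim (leading≢0 (Deg-* dege degD) (z (m ℕ.+ d) (ℕP.m≤n+m d m)))

open DivisionUniqueness 𝓓 Below-*⇒0

-- Division takes `u (a P + R)` and `u P` to the quotient `a` and the remainder `u R`, so the same
-- `u` serves for the next pair and never has to be cancelled. Removing the first term of the word
-- rewrites `P` and `R` into the shape required of that pair.
euclid-specializable : ∀ {N D qs P U R V} u a → EuclidCF N D qs → IsIntPoly a → CF P U R V →
  N ≋ u Q.*ₚ (a Q.*ₚ P Q.+ₚ R) → D ≋ u Q.*ₚ P → Specializable qs
euclid-specializable u a (stop _) _ _ _ _ = []
euclid-specializable {N} {D} {q ∷ qs} {P} {U} {R} {V} u a (step {r = r} D≢0 N≈ (k , Dk≢0 , r≡0) rest) Ia cf N≋ D≋ =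
  𝓓.Int-resp (≋-sym (proj₁ unique)) Ia ∷ continue cf rest
  where
  degD : ∃ (Deg D)
  degD = nonzero⇒Deg D D≢0
  -- `DegLt` only provides some index with a non-zero coefficient of `D`, not necessarily the
  -- degree.
  k≤degD : k ℕ.≤ proj₁ degD
  k≤degD = ℕP.≮⇒≥ (λ d<k → Dk≢0 (above≡0 (proj₂ degD) k d<k))
  unique : q ≋ a × r ≋ u Q.*ₚ R
  unique = quotient-unique {u = u} cf N≋ D≋ (mk≋ N≈) (proj₂ degD) (mkBelow λ j d≤j → r≡0 j (ℕP.≤-trans k≤degD d≤j))
  continue : CF P U R V → EuclidCF D r qs → Specializable qs
  -- For an exhausted word `R` is zero, hence so is the remainder `u R`, and the algorithm has to
  -- stop as well.
  continue (nil _ _ R≈0 _) (stop _) = []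
  continue (nil _ _ R≈0 _) (step (j , r≢0) _ _ _) = ⊥-elim (r≢0 (at r≋0 j))
    where
    r≋0 : r ≋ []
    r≋0 = ≋-trans (proj₂ unique) (≋-trans (*ₚ-cong {u} {u} {R} {[]} ≋-refl R≈0) (𝓓.zeroʳ u))
  continue (cons {a = a'} {D = P'} {R = R'} Ia' _ cf' P≈ _ R≈ _) rest =
    euclid-specializable u a' rest Ia' cf'
      (≋-trans D≋ (*ₚ-cong {u} {u} {P} {a' Q.*ₚ P' Q.+ₚ R'} ≋-refl P≈))
      (≋-trans (proj₂ unique) (*ₚ-cong {u} {u} {R} {P'} ≋-refl R≈))

-- Laurent series

open Series ℚ-field
module ℚS = IntegerSolver ℚP.+-*-commutativeRing

-- Exponents are counted downwards from `s`; a Laurent series of degree at most `s` thus becomes a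
-- power series in 1/x.
ser : (ℤ → ℚ) → ℤ → ℕ → ℚ
ser x s i = x (s ℤ.- + i)

Bounded : (ℤ → ℚ) → ℤ → Set
Bounded x s = ∀ j → s ℤ.< j → x j ≡ 0ℚ

-- v is the coefficient at xʲ of the product of two series of degrees at most s and t.
record Cauchy (x : ℤ → ℚ) (s : ℤ) (z : ℤ → ℚ) (t j : ℤ) (v : ℚ) : Set where
  constructor mkCauchy
  field
    within : ∀ i → j ≡ s ℤ.+ t ℤ.- + i → (ser x s ⋆ ser z t) i ≡ v
    beyond : s ℤ.+ t ℤ.< j → v ≡ 0ℚ
open Cauchy

private
  variable
    x x' z z' : ℤ → ℚ
    s s' t t' j : ℤ
    v w : ℚ

≤⇒offset : ∀ {j n} → j ℤ.≤ n → ∃ λ i → n ≡ j ℤ.+ + i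
≤⇒offset {j} {n} j≤n = ℤ.∣ n ℤ.- j ∣ , ≡.trans
  (ℤS.solve 2 (λ j n → n ℤS.:= j ℤS.:+ (n ℤS.:- j)) ≡.refl j n)
  (≡.cong (ℤ._+_ j) (≡.sym (ℤP.0≤i⇒+∣i∣≡i (ℤP.i≤j⇒0≤j-i j≤n))))

≤⇒index : ∀ {j n} → j ℤ.≤ n → ∃ λ i → j ≡ n ℤ.- + i
≤⇒index {j} {n} j≤n with ≤⇒offset j≤n
... | i , eq = i , ≡.trans (ℤS.solve 2 (λ j i → j ℤS.:= j ℤS.:+ i ℤS.:- i) ≡.refl j (+ i)) (≡.cong (ℤ._- + i) (≡.sym eq))

Cauchy-unique : Cauchy x s z t j v → Cauchy x s z t j w → v ≡ w
Cauchy-unique {s = s} {t = t} {j = j} C C' with j ℤP.≤? s ℤ.+ t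
... | yes le = let i , eq = ≤⇒index le in ≡.trans (≡.sym (within C i eq)) (within C' i eq)
... | no ¬le = ≡.trans (beyond C (ℤP.≰⇒> ¬le)) (≡.sym (beyond C' (ℤP.≰⇒> ¬le)))

Cauchy-cong : (∀ j → x j ≡ x' j) → (∀ j → z j ≡ z' j) → v ≡ w → Cauchy x s z t j v → Cauchy x' s z' t j w
Cauchy-cong x≡ z≡ ≡.refl (mkCauchy wi be) = mkCauchy
  (λ i eq → ≡.trans (⋆-cong (λ k → ≡.sym (x≡ _)) (λ k → ≡.sym (z≡ _)) i) (wi i eq)) be

Cauchy-comm : Cauchy x s z t j v → Cauchy z t x s j v
Cauchy-comm {x} {s} {z} {t} {j} (mkCauchy wi be) = mkCauchy
  (λ i eq → ≡.trans (⋆-comm (ser z t) (ser x s) i) (wi i (≡.trans eq (≡.cong (ℤ._- + i) (ℤP.+-comm t s)))))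
  (λ lt → be (≡.subst (ℤ._< j) (ℤP.+-comm t s) lt))

ser-suc : ∀ x s i → ser x (s ℤ.+ + 1) (suc i) ≡ ser x s i
ser-suc x s i = ≡.cong x (ℤS.solve 2 (λ s i → s ℤS.:+ ℤS.con (+ 1) ℤS.:- (ℤS.con (+ 1) ℤS.:+ i) ℤS.:= s ℤS.:- i) ≡.refl s (+ i))

n<n+1 : ∀ n → n ℤ.< n ℤ.+ + 1
n<n+1 n = ≡.subst (n ℤ.<_) (ℤP.+-comm (+ 1) n) (ℤP.suc[i]≤j⇒i<j ℤP.≤-refl)

ser-above : Bounded x s → ser x (s ℤ.+ + 1) 0 ≡ 0ℚ
ser-above {x} {s} bx = ≡.trans (≡.cong x (ℤP.+-identityʳ _)) (bx _ (n<n+1 s))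

s+1+t : ∀ s t → s ℤ.+ + 1 ℤ.+ t ≡ s ℤ.+ t ℤ.+ + 1
s+1+t = ℤS.solve 2 (λ s t → s ℤS.:+ ℤS.con (+ 1) ℤS.:+ t ℤS.:= s ℤS.:+ t ℤS.:+ ℤS.con (+ 1)) ≡.refl

-- A larger bound puts one zero in front of the coefficients, so every index moves by one. The new
-- index 0 belongs to an exponent outside the old range, where `beyond` supplies the value 0.
Cauchy-up₁ : Bounded x s → Cauchy x s z t j v → Cauchy x (s ℤ.+ + 1) z t j v
Cauchy-up₁ {x} {s} {z} {t} {j} {v} bx (mkCauchy wi be) = mkCauchy within' beyond'
  where
  s₁ = s ℤ.+ + 1
  within' : ∀ i → j ≡ s₁ ℤ.+ t ℤ.- + i → (ser x s₁ ⋆ ser z t) i ≡ v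
  within' zero    eq = ≡.trans (⋆-head (ser x s₁) (ser z t) (ser-above {x} {s} bx))
    (≡.sym (be (≡.subst (s ℤ.+ t ℤ.<_) (≡.sym (≡.trans eq (≡.trans (ℤP.+-identityʳ _) (s+1+t s t)))) (n<n+1 _))))
  within' (suc i) eq = ≡.trans (⋆-tail (ser x s₁) (ser z t) i (ser-above {x} {s} bx))
    (≡.trans (⋆-cong {b = ser z t} (ser-suc x s) (λ _ → ≡.refl) i) (wi i (≡.trans eq
      (ℤS.solve 3 (λ s t i → s ℤS.:+ ℤS.con (+ 1) ℤS.:+ t ℤS.:- (ℤS.con (+ 1) ℤS.:+ i) ℤS.:= s ℤS.:+ t ℤS.:- i) ≡.refl s t (+ i)))))
  beyond' : s₁ ℤ.+ t ℤ.< j → v ≡ 0ℚ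
  beyond' lt = be (ℤP.<-trans (n<n+1 _) (≡.subst (ℤ._< j) (s+1+t s t) lt))

Cauchy-down₁ : Bounded x s → Cauchy x (s ℤ.+ + 1) z t j v → Cauchy x s z t j v
Cauchy-down₁ {x} {s} {z} {t} {j} {v} bx (mkCauchy wi be) = mkCauchy within' beyond'
  where
  s₁ = s ℤ.+ + 1
  within' : ∀ i → j ≡ s ℤ.+ t ℤ.- + i → (ser x s ⋆ ser z t) i ≡ v
  within' i eq = ≡.trans
    (≡.sym (≡.trans (⋆-tail (ser x s₁) (ser z t) i (ser-above {x} {s} bx)) (⋆-cong {b = ser z t} (ser-suc x s) (λ _ → ≡.refl) i)))
    (wi (suc i) (≡.trans eq
      (ℤS.solve 3 (λ s t i → s ℤS.:+ t ℤS.:- i ℤS.:= s ℤS.:+ ℤS.con (+ 1) ℤS.:+ t ℤS.:- (ℤS.con (+ 1) ℤS.:+ i)) ≡.refl s t (+ i))))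
  beyond' : s ℤ.+ t ℤ.< j → v ≡ 0ℚ
  beyond' lt with s₁ ℤ.+ t ℤP.≟ j
  ... | yes eq = ≡.trans (≡.sym (wi 0 (≡.trans (≡.sym eq) (≡.sym (ℤP.+-identityʳ _))))) (⋆-head (ser x s₁) (ser z t) (ser-above {x} {s} bx))
  ... | no  ne = be (ℤP.≤∧≢⇒< (≡.subst (ℤ._≤ j) (≡.trans (ℤP.+-comm (+ 1) (s ℤ.+ t)) (≡.sym (s+1+t s t))) (ℤP.i<j⇒suc[i]≤j lt)) ne)

Bounded-+ : ∀ m → Bounded x s → Bounded x (s ℤ.+ + m)
Bounded-+ {s = s} m bx j lt = bx j (ℤP.≤-<-trans (ℤP.i≤i+j s (+ m)) lt)

s+1+m : ∀ s m → s ℤ.+ + m ℤ.+ + 1 ≡ s ℤ.+ + suc m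
s+1+m s m = ℤS.solve 2 (λ s m → s ℤS.:+ m ℤS.:+ ℤS.con (+ 1) ℤS.:= s ℤS.:+ (ℤS.con (+ 1) ℤS.:+ m)) ≡.refl s (+ m)

Cauchy-up : ∀ m → Bounded x s → Cauchy x s z t j v → Cauchy x (s ℤ.+ + m) z t j v
Cauchy-up {x} {s} {z} {t} {j} {v} zero bx C = ≡.subst (λ s → Cauchy x s z t j v) (≡.sym (ℤP.+-identityʳ s)) C
Cauchy-up {x} {s} {z} {t} {j} {v} (suc m) bx C = ≡.subst (λ s → Cauchy x s z t j v) (s+1+m s m)
  (Cauchy-up₁ {x} (Bounded-+ {x} m bx) (Cauchy-up m bx C))

Cauchy-down : ∀ m → Bounded x s → Cauchy x (s ℤ.+ + m) z t j v → Cauchy x s z t j v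
Cauchy-down {x} {s} {z} {t} {j} {v} zero bx C = ≡.subst (λ s → Cauchy x s z t j v) (ℤP.+-identityʳ s) C
Cauchy-down {x} {s} {z} {t} {j} {v} (suc m) bx C = Cauchy-down m bx
  (Cauchy-down₁ {x} (Bounded-+ {x} m bx) (≡.subst (λ s → Cauchy x s z t j v) (≡.sym (s+1+m s m)) C))

-- Products do not depend on the degree bounds chosen for the factors, so a bound can be exchanged
-- for whichever suits the next step, while `*L` only knows the stored `top`.
Cauchy-rebaseˡ : ∀ s' → Bounded x s → Bounded x s' → Cauchy x s z t j v → Cauchy x s' z t j v
Cauchy-rebaseˡ {s = s} s' bx bx' C with ℤP.≤-total s s'
... | inj₁ le with ≤⇒offset le
...   | m , ≡.refl = Cauchy-up m bx C
Cauchy-rebaseˡ {s = s} s' bx bx' C | inj₂ ge with ≤⇒offset ge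
...   | m , ≡.refl = Cauchy-down m bx' C

Cauchy-rebaseʳ : ∀ t' → Bounded z t → Bounded z t' → Cauchy x s z t j v → Cauchy x s z t' j v
Cauchy-rebaseʳ t' bz bz' C = Cauchy-comm (Cauchy-rebaseˡ t' bz bz' (Cauchy-comm C))

sum-suc : ∀ n (h : ℕ → ℚ) → sumℚ (suc n) h ≡ h 0 ℚ.+ sumℚ n (tail h)
sum-suc zero    h = ℚP.+-comm 0ℚ (h 0)
sum-suc (suc n) h = ≡.trans (≡.cong (ℚ._+ h (suc n)) (sum-suc n h)) (ℚP.+-assoc (h 0) (sumℚ n (tail h)) (h (suc n)))

sum-⋆ : ∀ n (h a b : ℕ → ℚ) → (∀ k → k ℕ.≤ n → h k ≡ a (n ℕ.∸ k) ℚ.* b k) → sumℚ (suc n) h ≡ (a ⋆ b) n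
sum-⋆ zero    h a b eq = ≡.trans (ℚP.+-identityˡ _) (eq 0 ℕ.z≤n)
sum-⋆ (suc n) h a b eq = ≡.trans (sum-suc (suc n) h) (≡.trans
  (≡.cong₂ ℚ._+_ (eq 0 ℕ.z≤n) (sum-⋆ n (tail h) a (tail b) (λ k k≤n → eq (suc k) (ℕ.s≤s k≤n))))
  (≡.sym (⋆-suc a b n)))

*L-Cauchy-top : ∀ α β j → Cauchy (c α) (top α) (c β) (top β) j (c (α *L β) j)
*L-Cauchy-top α β j = mkCauchy within' (mulBnd α β j)
  where
  within' : ∀ i → j ≡ top α ℤ.+ top β ℤ.- + i → (ser (c α) (top α) ⋆ ser (c β) (top β)) i ≡ mulCoeff α β j
  within' i ≡.refl with j ℤP.≤? (top α ℤ.+ top β)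
  ... | no ¬le = ⊥-elim (¬le (ℤP.i-j≤i (top α ℤ.+ top β) (+ i)))
  ... | yes _ = ≡.sym (≡.trans (≡.cong (λ n → sumℚ (suc n) h) index) (sum-⋆ i h _ _ summand))
    where
    h : ℕ → ℚ
    h k = c α (j ℤ.- top β ℤ.+ + k) ℚ.* c β (top β ℤ.- + k)
    index : ℤ.∣ top α ℤ.+ top β ℤ.- j ∣ ≡ i
    index = ≡.cong ℤ.∣_∣ (ℤS.solve 2 (λ n i → n ℤS.:- (n ℤS.:- i) ℤS.:= i) ≡.refl (top α ℤ.+ top β) (+ i))
    summand : ∀ k → k ℕ.≤ i → h k ≡ c α (top α ℤ.- + (i ℕ.∸ k)) ℚ.* c β (top β ℤ.- + k)
    summand k k≤i = ≡.cong (λ n → c α n ℚ.* c β (top β ℤ.- + k)) (≡.trans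
      (ℤS.solve 4 (λ s t i k → s ℤS.:+ t ℤS.:- i ℤS.:- t ℤS.:+ k ℤS.:= s ℤS.:- (i ℤS.:- k)) ≡.refl (top α) (top β) (+ i) (+ k))
      (≡.cong (λ n → top α ℤ.- n) (≡.trans (ℤP.m-n≡m⊖n i k) (ℤP.⊖-≥ k≤i))))

*L-Cauchy : ∀ α β s t → Bounded (c α) s → Bounded (c β) t → ∀ j → Cauchy (c α) s (c β) t j (c (α *L β) j)
*L-Cauchy α β s t bα bβ j = Cauchy-rebaseʳ {c β} t (bnd β) bβ (Cauchy-rebaseˡ {c α} s (bnd α) bα (*L-Cauchy-top α β j))

Cauchy-linear : ∀ k → Cauchy x s z t j v → Cauchy x' s z t j w → Cauchy (λ i → x i ℚ.+ k ℚ.* x' i) s z t j (v ℚ.+ k ℚ.* w)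
Cauchy-linear {x} {s} {z} {t} {x' = x'} k (mkCauchy wi be) (mkCauchy wi' be') = mkCauchy
  (λ i eq → ≡.trans (⋆-distribʳ (ser x s) (λ n → k ℚ.* ser x' s n) (ser z t) i)
    (≡.cong₂ ℚ._+_ (wi i eq) (≡.trans (⋆-scale k (ser x' s) (ser z t) i) (≡.cong (k ℚ.*_) (wi' i eq)))))
  (λ lt → ≡.trans (≡.cong₂ (λ v w → v ℚ.+ k ℚ.* w) (be lt) (be' lt)) (≡.trans (ℚP.+-identityˡ (k ℚ.* 0ℚ)) (ℚP.*-zeroʳ k)))

Cauchy-shift : Cauchy x s z t (j ℤ.- + 1) v → Cauchy (λ i → x (i ℤ.- + 1)) (+ 1 ℤ.+ s) z t j v
Cauchy-shift {x} {s} {z} {t} {j} (mkCauchy wi be) = mkCauchy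
  (λ i eq → ≡.trans
    (⋆-cong {b = ser z t} (λ n → ≡.cong x (ℤS.solve 2 (λ s n → ℤS.con (+ 1) ℤS.:+ s ℤS.:- n ℤS.:- ℤS.con (+ 1) ℤS.:= s ℤS.:- n) ≡.refl s (+ n))) (λ _ → ≡.refl) i)
    (wi i (≡.trans (≡.cong (ℤ._- + 1) eq)
      (ℤS.solve 3 (λ s t i → ℤS.con (+ 1) ℤS.:+ s ℤS.:+ t ℤS.:- i ℤS.:- ℤS.con (+ 1) ℤS.:= s ℤS.:+ t ℤS.:- i) ≡.refl s t (+ i)))))
  (λ lt → be (≡.subst (ℤ._< j ℤ.- + 1)
    (ℤS.solve 2 (λ s t → ℤS.con (+ 1) ℤS.:+ s ℤS.:+ t ℤS.:- ℤS.con (+ 1) ℤS.:= s ℤS.:+ t) ≡.refl s t)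
    (ℤP.+-monoˡ-< (ℤ.- + 1) lt)))

polyAt-Below : ∀ {p d} → Below p d → ∀ j → + d ℤ.≤ j → polyAt p j ≡ 0ℚ
polyAt-Below (mkBelow z) (+ k)    le = z k (ℤP.drop‿+≤+ le)
polyAt-Below (mkBelow z) -[1+ k ] le = ≡.refl

polyAt-Deg : ∀ {p d} → Deg p d → Bounded (polyAt p) (+ d)
polyAt-Deg (mkDeg _ z) (+ k)    lt = z k (ℤP.drop‿+<+ lt)
polyAt-Deg (mkDeg _ z) -[1+ k ] lt = ≡.refl

coeff-length : ∀ p → Below p (length p)
coeff-length p = mkBelow (go p)
  where
  go : ∀ p k → length p ℕ.≤ k → Q.coeff p k ≡ 0ℚ
  go []      k       le           = ≡.refl
  go (a ∷ p) (suc k) (ℕ.s≤s le) = go p k le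

polyAt-length : ∀ p → Bounded (polyAt p) (+ length p)
polyAt-length p j lt = polyAt-Below (coeff-length p) j (ℤP.<⇒≤ lt)

polyAt-cong : ∀ {p q} → p ≋ q → ∀ j → polyAt p j ≡ polyAt q j
polyAt-cong (mk≋ eq) (+ k)    = eq k
polyAt-cong (mk≋ eq) -[1+ k ] = ≡.refl

polyCoeff≡polyAt : ∀ p j → polyCoeff p j ≡ polyAt p j
polyCoeff≡polyAt p j with j ℤP.≤? + length p
... | yes _  = ≡.refl
... | no ¬le = ≡.sym (polyAt-length p j (ℤP.≰⇒> ¬le))

polyAt-+ : ∀ p q j → polyAt (p Q.+ₚ q) j ≡ polyAt p j ℚ.+ polyAt q j
polyAt-+ p q (+ k)    = coeff-+ p q k
polyAt-+ p q -[1+ k ] = ≡.refl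

polyAt-scale : ∀ a p j → polyAt (Q.scale a p) j ≡ a ℚ.* polyAt p j
polyAt-scale a p (+ k)    = coeff-scale a p k
polyAt-scale a p -[1+ k ] = ≡.sym (ℚP.*-zeroʳ a)

polyAt-shift : ∀ p j → polyAt p (j ℤ.- + 1) ≡ polyAt (0ℚ ∷ p) j
polyAt-shift p (+ zero)  = ≡.refl
polyAt-shift p (+ suc k) = ≡.refl
polyAt-shift p -[1+ k ]  = ≡.refl

polyAt-∷ : ∀ a p j → polyAt p (j ℤ.- + 1) ℚ.+ a ℚ.* polyAt one j ≡ polyAt (a ∷ p) j
polyAt-∷ a p (+ zero)  = ≡.trans (ℚP.+-identityˡ (a ℚ.* 1ℚ)) (ℚP.*-identityʳ a)
polyAt-∷ a p (+ suc k) = ≡.trans (≡.cong (ℚ._+_ (Q.coeff p k)) (ℚP.*-zeroʳ a)) (ℚP.+-identityʳ (Q.coeff p k))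
polyAt-∷ a p -[1+ k ]  = ≡.trans (ℚP.+-identityˡ (a ℚ.* 0ℚ)) (ℚP.*-zeroʳ a)

polyAt-[] : ∀ j → polyAt [] j ≡ 0ℚ
polyAt-[] (+ k)    = ≡.refl
polyAt-[] -[1+ k ] = ≡.refl

one-Bounded : Bounded (polyAt one) (+ 0)
one-Bounded (+ suc k) lt = ≡.refl
one-Bounded (+ zero)  (ℤ.+<+ ())
one-Bounded -[1+ k ]  lt = ≡.refl

one-Cauchy : Bounded z t → ∀ j → Cauchy (polyAt one) (+ 0) z t j (z j)
one-Cauchy {z} {t} bz j = mkCauchy
  (λ i eq → ≡.trans (⋆-constant (ser (polyAt one) (+ 0)) (ser z t) i (λ _ → ≡.refl))
    (≡.trans (ℚP.*-identityˡ (ser z t i)) (≡.cong z (≡.trans (≡.cong (ℤ._- + i) (≡.sym (ℤP.+-identityˡ t))) (≡.sym eq)))))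
  (λ lt → bz j (≡.subst (ℤ._< j) (ℤP.+-identityˡ t) lt))

-- Induction along `a ∷ p = x p + a`: `Cauchy-shift` accounts for the factor x and `Cauchy-linear`
-- for the added constant.
*ₚ-Cauchy-length : ∀ p q → Bounded (polyAt q) t → ∀ j → Cauchy (polyAt p) (+ length p) (polyAt q) t j (polyAt (p Q.*ₚ q) j)
*ₚ-Cauchy-length [] q bq j = mkCauchy
  (λ i _ → ≡.trans (0⋆ i (λ k → polyAt-[] (+ 0 ℤ.- + k))) (≡.sym (polyAt-[] j))) (λ _ → polyAt-[] j)
*ₚ-Cauchy-length {t} (a ∷ p) q bq j = Cauchy-cong (polyAt-∷ a p) (λ _ → ≡.refl) value
  (Cauchy-linear a (Cauchy-shift (*ₚ-Cauchy-length p q bq (j ℤ.- + 1)))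
    (Cauchy-rebaseˡ (+ length (a ∷ p)) one-Bounded (Bounded-+ {polyAt one} {+ 0} (length (a ∷ p)) one-Bounded) (one-Cauchy bq j)))
  where
  value : polyAt (p Q.*ₚ q) (j ℤ.- + 1) ℚ.+ a ℚ.* polyAt q j ≡ polyAt ((a ∷ p) Q.*ₚ q) j
  value = ≡.sym (≡.trans (polyAt-+ (Q.scale a q) (0ℚ ∷ p Q.*ₚ q) j) (≡.trans
    (≡.cong₂ ℚ._+_ (polyAt-scale a q j) (≡.sym (polyAt-shift (p Q.*ₚ q) j)))
    (ℚP.+-comm (a ℚ.* polyAt q j) (polyAt (p Q.*ₚ q) (j ℤ.- + 1)))))

*ₚ-Cauchy : ∀ p q s t → Bounded (polyAt p) s → Bounded (polyAt q) t → ∀ j →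
            Cauchy (polyAt p) s (polyAt q) t j (polyAt (p Q.*ₚ q) j)
*ₚ-Cauchy p q s t bp bq j = Cauchy-rebaseˡ s (polyAt-length p) bp (*ₚ-Cauchy-length p q bq j)

-- Partial quotients of a Laurent series from a rational approximation

leading-exponent : ∀ x t j → Bounded x t → ¬ x j ≡ 0ℚ → ∃ λ e → ¬ x e ≡ 0ℚ × Bounded x e
leading-exponent x t j bx xj≢0 with ≤⇒offset (ℤP.≮⇒≥ (λ t<j → xj≢0 (bx j t<j)))
... | m , ≡.refl = search m bx
  where
  -- Searching downwards from the bound ends at `j` at the latest, where the coefficient is known to
  -- be non-zero.
  search : ∀ m → Bounded x (j ℤ.+ + m) → ∃ λ e → ¬ x e ≡ 0ℚ × Bounded x e
  search zero    bx = j , xj≢0 , ≡.subst (Bounded x) (ℤP.+-identityʳ j) bx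
  search (suc m) bx with x (j ℤ.+ + suc m) ℚP.≟ 0ℚ
  ... | no  ≢0 = _ , ≢0 , bx
  ... | yes ≡0 = search m bx'
    where
    bx' : Bounded x (j ℤ.+ + m)
    bx' i lt with j ℤ.+ + suc m ℤP.≟ i
    ... | yes ≡.refl = ≡0
    ... | no  ne     = bx i (ℤP.≤∧≢⇒< (≡.subst (ℤ._≤ i)
      (ℤS.solve 2 (λ j m → ℤS.con (+ 1) ℤS.:+ (j ℤS.:+ m) ℤS.:= j ℤS.:+ (ℤS.con (+ 1) ℤS.:+ m)) ≡.refl j (+ m)) (ℤP.i<j⇒suc[i]≤j lt)) ne)

-- x r = p up to terms of degree at most d - K, where d is the degree of r.
Approx : (ℤ → ℚ) → QPoly → QPoly → ℕ → ℕ → Set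
Approx x r p d K = ∀ s → Bounded x s → ∀ j → + d ℤ.- + K ℤ.< j → Cauchy x s (polyAt r) (+ d) j (polyAt p j)

Approx-cong : ∀ {r r' p p' d K} → (∀ j → x j ≡ x' j) → r ≋ r' → p ≋ p' → Approx x r p d K → Approx x' r' p' d K
Approx-cong x≡ r≋ p≋ A s bx' j lt = Cauchy-cong x≡ (polyAt-cong r≋) (polyAt-cong p≋ j)
  (A s (λ i s<i → ≡.trans (x≡ i) (bx' i s<i)) j lt)

Approx-from : ∀ {r p d K} s → Bounded x s → (∀ j → + d ℤ.- + K ℤ.< j → Cauchy x s (polyAt r) (+ d) j (polyAt p j)) → Approx x r p d K
Approx-from s bx C s' bx' j lt = Cauchy-rebaseˡ s' bx bx' (C j lt)

-- Linear inequalities over ℤ are derived by shifting a known one by a suitable `k`; the ring solver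
-- then brings both sides into the required form.
translate-< : ∀ k {i j i' j'} → i ℤ.+ k ≡ i' → j ℤ.+ k ≡ j' → i ℤ.< j → i' ℤ.< j'
translate-< k ≡.refl ≡.refl = ℤP.+-monoˡ-< k

translate-≤ : ∀ k {i j i' j'} → i ℤ.+ k ≡ i' → j ℤ.+ k ≡ j' → i ℤ.≤ j → i' ℤ.≤ j'
translate-≤ k ≡.refl ≡.refl = ℤP.+-monoˡ-≤ k

i≤∣i∣ : ∀ i → i ℤ.≤ + ℤ.∣ i ∣
i≤∣i∣ (+ n)    = ℤP.≤-refl
i≤∣i∣ -[1+ n ] = ℤ.-≤+

-∣i∣≤i : ∀ i → ℤ.- + ℤ.∣ i ∣ ℤ.≤ i
-∣i∣≤i (+ n)    = ℤP.neg-≤-pos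
-∣i∣≤i -[1+ n ] = ℤP.≤-refl

polyAt-top : ∀ {p d} → Deg p d → ¬ ser (polyAt p) (+ d) 0 ≡ 0ℚ
polyAt-top {p} {d} degp eq = leading≢0 degp (≡.trans (≡.cong (polyAt p) (≡.sym (ℤP.+-identityʳ (+ d)))) eq)

-- With `Δ = x - a`, the product of `Δ` and `P` is `R` to the given precision, and `R` has degree
-- below `d`. So this product vanishes at all exponents from `d` on; cancelling the leading
-- coefficient of `P` leaves `Δ` without terms of exponent 0 or more, and `a` is the polynomial part
-- of `x`.
module PolynomialPart (P R a : QPoly) {d K : ℕ} {x : ℤ → ℚ} {s : ℤ}
  (degP : Deg P d) (belowR : Below R d) (bx : Bounded x s) (A : Approx x P (a Q.*ₚ P Q.+ₚ R) d (suc K)) where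

  N : ℕ
  N = ℤ.∣ s ∣ ℕ.+ length a

  Δ : ℤ → ℚ
  Δ j = x j ℚ.+ (ℚ.- 1ℚ) ℚ.* polyAt a j

  bx' : Bounded x (+ N)
  bx' j lt = bx j (ℤP.≤-<-trans (ℤP.≤-trans (i≤∣i∣ s) (ℤ.+≤+ (ℕP.m≤m+n ℤ.∣ s ∣ (length a)))) lt)

  ba : Bounded (polyAt a) (+ N)
  ba j lt = polyAt-length a j (ℤP.≤-<-trans (ℤ.+≤+ (ℕP.m≤n+m (length a) ℤ.∣ s ∣)) lt)

  Δ-Bounded : Bounded Δ (+ N)
  Δ-Bounded j lt = ≡.cong₂ (λ v w → v ℚ.+ (ℚ.- 1ℚ) ℚ.* w) (bx' j lt) (ba j lt)

  Δ-Cauchy : ∀ j → + d ℤ.- + suc K ℤ.< j → Cauchy Δ (+ N) (polyAt P) (+ d) j (polyAt R j)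
  Δ-Cauchy j lt = Cauchy-cong {x = Δ} (λ _ → ≡.refl) (λ _ → ≡.refl) value
    (Cauchy-linear (ℚ.- 1ℚ) (A (+ N) bx' j lt) (*ₚ-Cauchy a P (+ N) (+ d) ba (polyAt-Deg degP) j))
    where
    aP = polyAt (a Q.*ₚ P) j
    value : polyAt (a Q.*ₚ P Q.+ₚ R) j ℚ.+ (ℚ.- 1ℚ) ℚ.* aP ≡ polyAt R j
    value = ≡.trans (≡.cong (ℚ._+ (ℚ.- 1ℚ) ℚ.* aP) (polyAt-+ (a Q.*ₚ P) R j))
      (ℚS.solve 2 (λ v w → v ℚS.:+ w ℚS.:+ (ℚS.:- ℚS.con (+ 1)) ℚS.:* v ℚS.:= w) ≡.refl aP (polyAt R j))

  Δ-polynomial : ∀ n → Δ (+ n) ≡ 0ℚ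
  Δ-polynomial n with n ℕP.≤? N
  ... | no  n≰N = Δ-Bounded (+ n) (ℤ.+<+ (ℕP.≰⇒> n≰N))
  ... | yes n≤N = ≡.trans (≡.cong Δ (≡.sym index))
    (⋆-cancelʳ-< (suc N) (polyAt-top degP) vanish (N ℕ.∸ n) (ℕ.s≤s (ℕP.m∸n≤m N n)))
    where
    index : + N ℤ.- + (N ℕ.∸ n) ≡ + n
    index = ≡.trans (ℤP.m-n≡m⊖n N (N ℕ.∸ n))
      (≡.trans (ℤP.⊖-≥ (ℕP.m∸n≤m N n)) (≡.cong +_ (ℕP.m∸[m∸n]≡n n≤N)))
    vanish : ∀ i → i ℕ.< suc N → (ser Δ (+ N) ⋆ ser (polyAt P) (+ d)) i ≡ 0ℚ
    vanish i (ℕ.s≤s i≤N) = ≡.trans (within (Δ-Cauchy _ (ℤP.<-≤-trans d-K<d d≤j)) i ≡.refl) (polyAt-Below belowR _ d≤j)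
      where
      d≤j : + d ℤ.≤ + N ℤ.+ + d ℤ.- + i
      d≤j = translate-≤ (+ d ℤ.- + i)
        (ℤS.solve 2 (λ d i → i ℤS.:+ (d ℤS.:- i) ℤS.:= d) ≡.refl (+ d) (+ i))
        (ℤS.solve 3 (λ d i N → N ℤS.:+ (d ℤS.:- i) ℤS.:= N ℤS.:+ d ℤS.:- i) ≡.refl (+ d) (+ i) (+ N)) (ℤ.+≤+ i≤N)
      d-K<d : + d ℤ.- + suc K ℤ.< + d
      d-K<d = translate-< (+ d) (ℤP.+-comm (ℤ.- + suc K) (+ d)) (ℤP.+-identityˡ (+ d)) ℤ.-<+

  coefficients : ∀ n → x (+ n) ≡ Q.coeff a n
  coefficients n = ≡.trans (ℚS.solve 2 (λ v w → v ℚS.:= v ℚS.:+ (ℚS.:- ℚS.con (+ 1)) ℚS.:* w ℚS.:+ w) ≡.refl (x (+ n)) (Q.coeff a n))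
    (≡.trans (≡.cong (ℚ._+ Q.coeff a n) (Δ-polynomial n)) (ℚP.+-identityˡ (Q.coeff a n)))

  Δ-Approx : Approx Δ P R d (suc K)
  Δ-Approx = Approx-from {K = suc K} (+ N) Δ-Bounded Δ-Cauchy

fractional-Approx : ∀ α {P R a d K} → Deg P d → Below R d → Approx (c α) P (a Q.*ₚ P Q.+ₚ R) d (suc K) →
                    Approx (c (frac α)) P R d (suc K)
fractional-Approx α {P} {R} {a} {K = K} degP belowR A = Approx-cong {K = suc K} frac≡ ≋-refl ≋-refl Δ-Approx
  where
  open PolynomialPart P R a degP belowR (bnd α) A
  frac≡ : ∀ j → Δ j ≡ fracCoeff α j
  frac≡ j with + 0 ℤP.≤? j
  frac≡ (+ n)    | yes _   = Δ-polynomial n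
  frac≡ (+ n)    | no  0≰n = ⊥-elim (0≰n (ℤ.+≤+ ℕ.z≤n))
  frac≡ -[1+ n ] | no  _   = ≡.trans (≡.cong (ℚ._+_ (c α -[1+ n ])) (ℚP.*-zeroʳ (ℚ.- 1ℚ))) (ℚP.+-identityʳ (c α -[1+ n ]))

module NextQuotient {P R : QPoly} {d K : ℕ} {x : ℤ → ℚ} {e : ℤ} (degP : Deg P d)
  (xe≢0 : ¬ x e ≡ 0ℚ) (bx : Bounded x e) (A : Approx x P R d K) where

  module _ (-K<e : ℤ.- + K ℤ.< e) where
    private
      bound : + d ℤ.- + K ℤ.< e ℤ.+ + d
      bound = translate-< (+ d) (ℤP.+-comm (ℤ.- + K) (+ d)) ≡.refl -K<e

      leading : ¬ polyAt R (e ℤ.+ + d) ≡ 0ℚ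
      leading eq = *-nonzero {x (e ℤ.- + 0)} (λ eq → xe≢0 (≡.trans (≡.cong x (≡.sym (ℤP.+-identityʳ e))) eq)) (polyAt-top degP)
        (≡.trans (within (A e bx (e ℤ.+ + d) bound) 0 (≡.sym (ℤP.+-identityʳ _))) eq)

      natural : ∀ j → ¬ polyAt R j ≡ 0ℚ → ∃ λ d' → + d' ≡ j × ¬ Q.coeff R d' ≡ 0ℚ
      natural (+ n)    ne = n , ≡.refl , ne
      natural -[1+ n ] ne = ⊥-elim (ne ≡.refl)

    -- The leading terms of `x` and `P` give a non-zero term at exponent `e + d`. It lies within the
    -- precision and is therefore a coefficient of the polynomial `R`, which forces `e + d` to be a
    -- natural number.
    degree-R : ∃ λ d' → + d' ≡ e ℤ.+ + d × Deg R d'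
    degree-R with natural (e ℤ.+ + d) leading
    ... | d' , eq , ne = d' , eq , mkDeg ne λ k d'<k → let lt = ≡.subst (ℤ._< + k) eq (ℤ.+<+ d'<k) in
      beyond (A e bx (+ k) (ℤP.<-trans bound lt)) lt

  -- From x P ≈ R and y x = 1 we get y R ≈ P; the precision drops by the degrees of x and y.
  reciprocal-Approx : ∀ {y t K' d'} → Bounded y t → (∀ j → Cauchy y t x e j (polyAt one j)) →
    + d' ≡ e ℤ.+ + d → K ≡ suc (K' ℕ.+ ℤ.∣ t ∣ ℕ.+ ℤ.∣ e ∣) → Approx y R P d' K'
  reciprocal-Approx {y} {t} {K'} {d'} by yx≡1 d'≡ ≡.refl = Approx-from {K = K'} t by λ j lt → mkCauchy (within' j lt) (beyond' j)
    where
    one-bounded : Bounded (polyAt one) (t ℤ.+ e)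
    one-bounded j lt = beyond (yx≡1 j) lt
    one-P : ∀ j → Cauchy (polyAt one) (t ℤ.+ e) (polyAt P) (+ d) j (polyAt P j)
    one-P j = Cauchy-rebaseˡ (t ℤ.+ e) one-Bounded one-bounded (one-Cauchy (polyAt-Deg degP) j)
    t+d' : t ℤ.+ + d' ≡ t ℤ.+ e ℤ.+ + d
    t+d' = ≡.trans (≡.cong (ℤ._+_ t) d'≡) (≡.sym (ℤP.+-assoc t e (+ d)))
    beyond' : ∀ j → t ℤ.+ + d' ℤ.< j → polyAt P j ≡ 0ℚ
    beyond' j lt = beyond (one-P j) (≡.subst (ℤ._< j) t+d' lt)
    within' : ∀ j → + d' ℤ.- + K' ℤ.< j → ∀ i → j ≡ t ℤ.+ + d' ℤ.- + i → (ser y t ⋆ ser (polyAt R) (+ d')) i ≡ polyAt P j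
    within' j lt i ≡.refl = begin
      (ser y t ⋆ ser (polyAt R) (+ d')) i
        ≡⟨ ⋆-cong-≤ {a = ser y t} i (λ _ _ → ≡.refl) (λ k k≤i → ≡.trans (≡.cong (λ n → polyAt R (n ℤ.- + k)) d'≡)
             (≡.sym (within (A e bx _ (bound k k≤i)) k ≡.refl))) ⟩
      (ser y t ⋆ (ser x e ⋆ ser (polyAt P) (+ d))) i
        ≡⟨ ⋆-assoc (ser y t) (ser x e) (ser (polyAt P) (+ d)) i ⟨
      (ser y t ⋆ ser x e ⋆ ser (polyAt P) (+ d)) i
        ≡⟨ ⋆-cong {b = ser (polyAt P) (+ d)} (λ k → within (yx≡1 _) k ≡.refl) (λ _ → ≡.refl) i ⟩
      (ser (polyAt one) (t ℤ.+ e) ⋆ ser (polyAt P) (+ d)) i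
        ≡⟨ within (one-P j) i (≡.cong (ℤ._- + i) t+d') ⟩
      polyAt P j ∎
      where
      open ≡.≡-Reasoning
      -- The product uses coefficients of `R` down to exponent `e + d - i`. These are known while
      -- `i < e + K`; the hypothesis `lt` gives `i < t + K'`, and `K` exceeds `K'` by enough to make
      -- up for `t` and `e`.
      bound : ∀ k → k ℕ.≤ i → + d ℤ.- + K ℤ.< e ℤ.+ + d ℤ.- + k
      bound k k≤i = translate-< (+ d ℤ.- + K ℤ.- + k)
        (ℤS.solve 3 (λ k d K → k ℤS.:+ (d ℤS.:- K ℤS.:- k) ℤS.:= d ℤS.:- K) ≡.refl (+ k) (+ d) (+ K))
        (ℤS.solve 4 (λ e k d K → e ℤS.:+ K ℤS.:+ (d ℤS.:- K ℤS.:- k) ℤS.:= e ℤS.:+ d ℤS.:- k) ≡.refl e (+ k) (+ d) (+ K))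
        (ℤP.≤-<-trans (ℤ.+≤+ k≤i) (ℤP.<-≤-trans i<t+K' t+K'≤e+K))
        where
        i<t+K' : + i ℤ.< t ℤ.+ + K'
        i<t+K' = translate-< (+ i ℤ.+ + K' ℤ.- + d')
          (ℤS.solve 3 (λ d' K' i → d' ℤS.:- K' ℤS.:+ (i ℤS.:+ K' ℤS.:- d') ℤS.:= i) ≡.refl (+ d') (+ K') (+ i))
          (ℤS.solve 4 (λ t d' K' i → t ℤS.:+ d' ℤS.:- i ℤS.:+ (i ℤS.:+ K' ℤS.:- d') ℤS.:= t ℤS.:+ K') ≡.refl t (+ d') (+ K') (+ i)) lt
        T = + ℤ.∣ t ∣
        E = + ℤ.∣ e ∣
        t+K'≤e+K : t ℤ.+ + K' ℤ.≤ e ℤ.+ + K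
        t+K'≤e+K = ℤP.≤-trans (ℤP.+-monoˡ-≤ (+ K') (i≤∣i∣ t)) (ℤP.≤-trans (ℤP.i≤suc[i] _)
          (translate-≤ (E ℤ.+ (+ 1 ℤ.+ T ℤ.+ + K'))
            (ℤS.solve 3 (λ E T K' → ℤS.:- E ℤS.:+ (E ℤS.:+ (ℤS.con (+ 1) ℤS.:+ T ℤS.:+ K')) ℤS.:= ℤS.con (+ 1) ℤS.:+ (T ℤS.:+ K')) ≡.refl E T (+ K'))
            (ℤS.solve 4 (λ e E T K' → e ℤS.:+ (E ℤS.:+ (ℤS.con (+ 1) ℤS.:+ T ℤS.:+ K')) ℤS.:= e ℤS.:+ (ℤS.con (+ 1) ℤS.:+ (K' ℤS.:+ T ℤS.:+ E))) ≡.refl e E T (+ K'))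
            (-∣i∣≤i e)))

CF-Below : ∀ {P U R V d} → CF P U R V → Deg P d → Below R d
CF-Below {R = R} cf degP = ≡.subst (Below R) (Deg-unique Deg-D degP) Below-R
  where open Degrees (CF-Degrees cf)

-- The partial quotients of α are read off any sufficiently good rational approximation.
approx-specializable : ∀ {α qs} → CFPrefix α qs → ∃ λ K → ∀ {P U R V} a → IsIntPoly a → CF P U R V →
  ∀ d → Deg P d → Approx (c α) P (a Q.*ₚ P Q.+ₚ R) d (suc K) → Specializable qs
approx-specializable nil = 0 , λ _ _ _ _ _ _ → []
approx-specializable {α} (last {q = q} q≡) = 0 , λ {P} {U} {R} a Ia cf d degP A →
  let open PolynomialPart P R a degP (CF-Below cf degP) (bnd α) A in
  𝓓.Int-resp {a} {q} (mk≋ (λ n → ≡.sym (≡.trans (q≡ n) (coefficients n)))) Ia ∷ []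
approx-specializable {α} (cons {β = β} {q = q} {qs = qs} q≡ (j , ne) βφ≡1 rest)
  with approx-specializable rest | leading-exponent (c (frac α)) (+ 0) j (bnd (frac α)) ne
... | K' , continue | e , φe≢0 , φ-bounded = K , go
  where
  K : ℕ
  -- An inversion costs the degrees of `β` and of the fractional part: `suc K` is what
  -- `reciprocal-Approx` asks for in order to leave the precision `suc K'`. It is also large enough
  -- for the leading term at `e` to be visible.
  K = suc K' ℕ.+ ℤ.∣ top β ∣ ℕ.+ ℤ.∣ e ∣
  go : ∀ {P U R V} a → IsIntPoly a → CF P U R V → ∀ d → Deg P d →
       Approx (c α) P (a Q.*ₚ P Q.+ₚ R) d (suc K) → Specializable (q ∷ qs)
  go {P} {U} {R} {V} a Ia cf d degP A =
    𝓓.Int-resp {a} {q} (mk≋ (λ n → ≡.sym (≡.trans (q≡ n) (coefficients n)))) Ia ∷ next cf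
    where
    belowR = CF-Below cf degP
    open PolynomialPart P R a degP belowR (bnd α) A
    open NextQuotient {P} {R} {K = suc K} {x = c (frac α)} degP φe≢0 φ-bounded (fractional-Approx α {P} {R} {a} {K = K} degP belowR A)
    -K<e : ℤ.- + suc K ℤ.< e
    -K<e = ℤP.<-≤-trans (ℤP.neg-mono-< (ℤ.+<+ (ℕ.s≤s (ℕP.m≤n+m ℤ.∣ e ∣ _)))) (-∣i∣≤i e)
    product : ∀ j → Cauchy (c β) (top β) (c (frac α)) e j (polyAt one j)
    product j = Cauchy-cong {x = c β} {z = c (frac α)} (λ _ → ≡.refl) (λ _ → ≡.refl) (≡.trans (βφ≡1 j) (polyCoeff≡polyAt one j))
      (*L-Cauchy β (frac α) (top β) e (bnd β) φ-bounded j)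
    d' = proj₁ (degree-R -K<e)
    d'≡ = proj₁ (proj₂ (degree-R -K<e))
    degR : Deg R d'
    degR = proj₂ (proj₂ (degree-R -K<e))
    A' : Approx (c β) R P d' (suc K')
    A' = reciprocal-Approx {K' = suc K'} (bnd β) product d'≡ ≡.refl
    next : CF P U R V → Specializable qs
    -- The word cannot end here: the fractional part of `α` has a visible leading term, so `R` is
    -- non-zero.
    next (nil _ _ R≈0 _) = ⊥-elim (leading≢0 degR (at R≈0 d'))
    next (cons {a = a'} {D = P'} {R = R'} Ia' _ cf' P≈ _ R≈ _) =
      continue a' Ia' cf' d' (Deg-resp R≈ degR) (Approx-cong {x = c β} {d = d'} {K = suc K'} (λ _ → ≡.refl) R≈ P≈ A')

-- Rational functions as Laurent series

module LaurentQuotient (N P : QPoly) {d : ℕ} (degP : Deg P d) where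
  private
    t₀ : ℤ
    t₀ = + length N ℤ.- + d

    open Division (ser (polyAt P) (+ d)) (polyAt-top degP)

    q : ℕ → ℚ
    q = divide (ser (polyAt N) (+ length N))

  quotientCoeff : ℤ → ℚ
  quotientCoeff j with j ℤP.≤? t₀
  ... | yes _ = q ℤ.∣ t₀ ℤ.- j ∣
  ... | no  _ = 0ℚ

  quotientBnd : Bounded quotientCoeff t₀
  quotientBnd j lt with j ℤP.≤? t₀
  ... | yes le = ⊥-elim (ℤP.<⇒≱ lt le)
  ... | no  _  = ≡.refl

  -- `IsInfProduct` compares `F` with the Laurent series whose product with the denominator is the
  -- numerator. To use it, such a series has to be exhibited; long division, starting from the
  -- leading coefficients, provides one.
  quotient : Laurent
  quotient = record { c = quotientCoeff ; top = t₀ ; bnd = quotientBnd }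

  ser-quotient : ∀ i → ser quotientCoeff t₀ i ≡ q i
  ser-quotient i with (t₀ ℤ.- + i) ℤP.≤? t₀
  ... | no ¬le = ⊥-elim (¬le (ℤP.i-j≤i t₀ (+ i)))
  ... | yes _  = ≡.cong (λ n → q ℤ.∣ n ∣) (ℤS.solve 2 (λ t₀ i → t₀ ℤS.:- (t₀ ℤS.:- i) ℤS.:= i) ≡.refl t₀ (+ i))

  quotient-Cauchy : ∀ j → Cauchy quotientCoeff t₀ (polyAt P) (+ d) j (polyAt N j)
  quotient-Cauchy j = mkCauchy
    (λ i eq → ≡.trans (⋆-cong {b = ser (polyAt P) (+ d)} ser-quotient (λ _ → ≡.refl) i)
      (≡.trans (divide-⋆ (ser (polyAt N) (+ length N)) i)
        (≡.cong (polyAt N) (≡.sym (≡.trans eq (≡.cong (ℤ._- + i) t+d))))))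
    (λ lt → polyAt-length N j (≡.subst (ℤ._< j) t+d lt))
    where
    t+d : t₀ ℤ.+ + d ≡ + length N
    t+d = ℤS.solve 2 (λ l d → l ℤS.:- d ℤS.:+ d ℤS.:= l) ≡.refl (+ length N) (+ d)

  quotient-*L : ∀ {num den} u → num ≋ u Q.*ₚ N → den ≋ u Q.*ₚ P → quotient *L embL den ≈L embL num
  quotient-*L {num} {den} u num≋ den≋ j = ≡.trans
    (Cauchy-unique (*L-Cauchy quotient (embL den) t₀ L+d quotientBnd den-bounded j) (mkCauchy within' beyond'))
    (≡.sym (≡.trans (polyCoeff≡polyAt num j) (polyAt-cong num≋ j)))
    where
    L = + length u
    L+d = L ℤ.+ + d
    u-P : ∀ j → Cauchy (polyAt u) L (polyAt P) (+ d) j (polyAt (u Q.*ₚ P) j)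
    u-P = *ₚ-Cauchy u P L (+ d) (polyAt-length u) (polyAt-Deg degP)
    u-N : ∀ j → Cauchy (polyAt u) L (polyAt N) (t₀ ℤ.+ + d) j (polyAt (u Q.*ₚ N) j)
    u-N = *ₚ-Cauchy u N L (t₀ ℤ.+ + d) (polyAt-length u) (λ j lt → beyond (quotient-Cauchy j) lt)
    den≡ : ∀ j → polyCoeff den j ≡ polyAt (u Q.*ₚ P) j
    den≡ j = ≡.trans (polyCoeff≡polyAt den j) (polyAt-cong den≋ j)
    den-bounded : Bounded (polyCoeff den) L+d
    den-bounded j lt = ≡.trans (den≡ j) (beyond (u-P j) lt)
    exchange : t₀ ℤ.+ L+d ≡ L ℤ.+ (t₀ ℤ.+ + d)
    exchange = ℤS.solve 3 (λ t₀ L d → t₀ ℤS.:+ (L ℤS.:+ d) ℤS.:= L ℤS.:+ (t₀ ℤS.:+ d)) ≡.refl t₀ L (+ d)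
    beyond' : t₀ ℤ.+ L+d ℤ.< j → polyAt (u Q.*ₚ N) j ≡ 0ℚ
    beyond' lt = beyond (u-N j) (≡.subst (ℤ._< j) exchange lt)
    within' : ∀ i → j ≡ t₀ ℤ.+ L+d ℤ.- + i → (ser quotientCoeff t₀ ⋆ ser (polyCoeff den) L+d) i ≡ polyAt (u Q.*ₚ N) j
    within' i eq = begin
      (sq ⋆ ser (polyCoeff den) L+d) i
        ≡⟨ ⋆-cong {a = sq} (λ _ → ≡.refl) (λ k → ≡.trans (den≡ (L+d ℤ.- + k)) (≡.sym (within (u-P _) k ≡.refl))) i ⟩
      (sq ⋆ (su ⋆ sP)) i
        ≡⟨ ⋆-comm sq (su ⋆ sP) i ⟩
      (su ⋆ sP ⋆ sq) i
        ≡⟨ ⋆-assoc su sP sq i ⟩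
      (su ⋆ (sP ⋆ sq)) i
        ≡⟨ ⋆-cong {a = su} (λ _ → ≡.refl) (λ k → ≡.trans (⋆-comm sP sq k) (within (quotient-Cauchy _) k ≡.refl)) i ⟩
      (su ⋆ ser (polyAt N) (t₀ ℤ.+ + d)) i
        ≡⟨ within (u-N j) i (≡.trans eq (≡.cong (ℤ._- + i) exchange)) ⟩
      polyAt (u Q.*ₚ N) j ∎
      where
      open ≡.≡-Reasoning
      sq = ser quotientCoeff t₀
      su = ser (polyAt u) L
      sP = ser (polyAt P) (+ d)

  -- Since `P` has degree `d`, coefficient `j` of a product with `P` involves only coefficients of
  -- exponent at least `j - d` of the other factor.
  Approx-near-quotient : ∀ F {K} → (∀ j → ℤ.- + K ℤ.≤ j → c F j ≡ quotientCoeff j) → Approx (c F) P N d K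
  Approx-near-quotient F {K} close = Approx-from {K = K} s₀ bF λ j lt → mkCauchy (within' j lt)
    (λ s+d<j → beyond (C j) s+d<j)
    where
    s₀ : ℤ
    s₀ = + (ℤ.∣ top F ∣ ℕ.+ ℤ.∣ t₀ ∣)
    bF : Bounded (c F) s₀
    bF j lt = bnd F j (ℤP.≤-<-trans (ℤP.≤-trans (i≤∣i∣ (top F)) (ℤ.+≤+ (ℕP.m≤m+n ℤ.∣ top F ∣ ℤ.∣ t₀ ∣))) lt)
    bq : Bounded quotientCoeff s₀
    bq j lt = quotientBnd j (ℤP.≤-<-trans (ℤP.≤-trans (i≤∣i∣ t₀) (ℤ.+≤+ (ℕP.m≤n+m ℤ.∣ t₀ ∣ ℤ.∣ top F ∣))) lt)
    C : ∀ j → Cauchy quotientCoeff s₀ (polyAt P) (+ d) j (polyAt N j)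
    C j = Cauchy-rebaseˡ s₀ quotientBnd bq (quotient-Cauchy j)
    within' : ∀ j → + d ℤ.- + K ℤ.< j → ∀ i → j ≡ s₀ ℤ.+ + d ℤ.- + i → (ser (c F) s₀ ⋆ ser (polyAt P) (+ d)) i ≡ polyAt N j
    within' j lt i ≡.refl = ≡.trans
      (⋆-cong-≤ {b = ser (polyAt P) (+ d)} i (λ k k≤i → close (s₀ ℤ.- + k) (ℤP.≤-trans -K≤s-i (ℤP.+-monoʳ-≤ s₀ (ℤP.neg-mono-≤ (ℤ.+≤+ k≤i))))) (λ _ _ → ≡.refl))
      (within (C j) i ≡.refl)
      where
      -K≤s-i : ℤ.- + K ℤ.≤ s₀ ℤ.- + i
      -K≤s-i = translate-≤ (ℤ.- + d)
        (ℤS.solve 2 (λ d K → d ℤS.:- K ℤS.:+ ℤS.:- d ℤS.:= ℤS.:- K) ≡.refl (+ d) (+ K))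
        (ℤS.solve 3 (λ s₀ d i → s₀ ℤS.:+ d ℤS.:- i ℤS.:+ ℤS.:- d ℤS.:= s₀ ℤS.:- i) ≡.refl s₀ (+ d) (+ i)) (ℤP.<⇒≤ lt)

theorem3p1 : (f G g : ZPoly) →
    Z.NonZeroP f → Z.NonZeroP G → Z.NonZeroP g →
    DegAtLeast3 f → Form f G g →
    ((n : ℕ) (qs : List QPoly) → S-is f n qs → Specializable qs)
    × ((F : Laurent) → IsInfProduct f F →
    (qs : List QPoly) → CFPrefix F qs → Specializable qs)
theorem3p1 f G g _ G≢0 g≢0 f≥3 form = finite , infinite
  where
  convergent : ∀ n → Convergent (numer f n) (denom f n)
  convergent = convergents f G g G≢0 g≢0 f≥3 form
  finite : (n : ℕ) (qs : List QPoly) → S-is f n qs → Specializable qs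
  finite n qs S = euclid-specializable u a S Int-a cf num≈ den≈
    where open Convergent (convergent n)
  infinite : (F : Laurent) → IsInfProduct f F → (qs : List QPoly) → CFPrefix F qs → Specializable qs
  infinite F F≡∏ qs prefix with approx-specializable prefix
  ... | K , specializable with F≡∏ (suc K)
  -- From index `M` on the partial products agree with `F` at all exponents from `- suc K` upwards.
  -- The index `M` itself is enough, with `quotient` as the series of its partial product.
  ...   | M , close = specializable a Int-a cf degree Deg-D
    (Approx-near-quotient F {suc K} (close M ℕP.≤-refl quotient (quotient-*L u num≈ den≈)))
    where
    open Convergent (convergent M)
    open Degrees (CF-Degrees cf)
    open LaurentQuotient (a Q.*ₚ P Q.+ₚ R) P Deg-D
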